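{- For all integers $n\ge s\ge 0$, \[ \mathrm{ex}(n,s)\le 3n^2-15ns+20s^2. \] Moreover, for $s\in\left[\frac38 n,\frac25 n\right]$ equality holds.
   Context: $\mathrm{ex}(n,s)$ is the maximum number of edges in a triangle-free graph on $n$ vertices with independence number at most $s$. -}

module Defs where

open import Data.Nat using (ℕ; _≤_; _<ᵇ_)
open import Data.Bool using (Bool; true; false; _∧_; if_then_else_)
open import Data.Fin using (Fin; toℕ)
open import Data.Fin.Subset using (Subset; _∈_; ∣_∣)
open import Data.List using (List; map; allFin)
open import Data.Nat.ListAction using (sum)
open import Data.Empty using (⊥)
open import Relation.Binary.PropositionalEquality using (_≡_)

record SimpleGraph (n : ℕ) : Set where
  field
    adj    : Fin n → Fin n → Bool
    sym    : ∀ i j → adj i j ≡ adj j i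
    irrefl : ∀ i → adj i i ≡ false
open SimpleGraph public

Adj : ∀ {n} → SimpleGraph n → Fin n → Fin n → Set
Adj G i j = adj G i j ≡ true

TriangleFree : ∀ {n} → SimpleGraph n → Set
TriangleFree G = ∀ i j k → Adj G i j → Adj G j k → Adj G i k → ⊥

Independent : ∀ {n} → SimpleGraph n → Subset n → Set
Independent G S = ∀ i j → i ∈ S → j ∈ S → Adj G i j → ⊥

IndepNumberAtMost : ∀ {n} → SimpleGraph n → ℕ → Set
IndepNumberAtMost {n} G s = (S : Subset n) → Independent G S → ∣ S ∣ ≤ s

edgeCount : ∀ {n} → SimpleGraph n → ℕ
edgeCount {n} G =
  sum (map (λ i → sum (map (λ j → if (toℕ j <ᵇ toℕ i) ∧ adj G i j then 1 else 0)
                           (allFin n)))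
           (allFin n))

{-# OPTIONS --safe #-}

-- Write n = 5a + 8b, s = 2a + 3b and m = a + b = 3s − n; the bound says that the degree sum is at most ns − ab.
-- It is trivial unless a, b > 0, because neighbourhoods are independent. Otherwise we symmetrise: if every
-- independent s-set disjoint from an s-set X contains z, then the neighbourhood of z can be replaced by X.
-- The intersection of a family of maximum independent sets has at least 2s − |union| elements, so this can be
-- repeated until m vertices have neighbourhood exactly X. In this way one finds s-sets A, B with A ∩ B = ∅ and
-- m vertices attached to each; deleting an edge between these two classes and using induction yields an s-set C
-- avoiding both, and then a path A, B, D, C of consecutively disjoint s-sets with m vertices attached to each of
-- A, B, D. Let E be a largest independent set disjoint from A ∪ C, of size s − k. If k > a, then the vertices of
-- C ∩ A have degree at most s − a and there are enough of them. If k ≤ a, then A, B, D, C, E is a (slightly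
-- defective) pentagon; after symmetrising towards C and E as well, the degree of every vertex is controlled by
-- which of the five sets contain it, and summing these estimates gives the claim.
-- Equality is attained by a blow-up of the Wagner graph.

module Submission where

-- In terms of `n` and `s` the parameters are `a = 8s - 3n` and `b = 2n - 5s`, which vanish at the
-- two ends of the interval of equality. The number `m` arises because the independent `s`-sets
-- disjoint from an `s`-set `X` have at most `n - s` vertices in their union, hence at least
-- `3s - n` in common. Redirecting a vertex to an `s`-set never lowers the degree sum, since no
-- degree exceeds `s`. The obstacle is the fifth set of the pentagon: nothing provides an
-- independent `s`-set that avoids both `A` and `C`, and symmetrising towards a smaller `E` pays
-- only for vertices of degree at most `s - k`. Every vertex of `A ∩ C` has degree at most `s - k`
-- or at most `s - a`, and this dichotomy serves both cases: for `k > a` it gives the saving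
-- directly, for `k ≤ a` it licenses the redirections towards `E`. The defect then adds
-- `k * k - 2 * a * k` to the final estimate, which is not positive.

open import Defs hiding (sym)
open import Data.Bool using (Bool; true; false; T; _∧_; _∨_; not; if_then_else_)
import Data.Bool.Properties as Bool
open import Data.Empty using (⊥; ⊥-elim)
open import Data.Fin using (Fin; zero; suc; toℕ; _≟_; punchIn; punchOut; _↑ˡ_; _↑ʳ_; splitAt; combine; remQuot)
open import Data.Fin.Patterns using (0F; 1F; 2F; 3F; 4F; 6F)
open import Data.Fin.Properties using (all?; any?; punchIn-punchOut; toℕ-injective; splitAt-↑ˡ; splitAt-↑ʳ; remQuot-combine)
open import Data.Fin.Subset using (Subset; _∈_; ∣_∣)
open import Data.Fin.Subset.Properties using (anySubset?)
open import Data.Integer using (ℤ; _⊖_) renaming (+_ to pos; _+_ to _+ℤ_; _-_ to _-ℤ_; _*_ to _*ℤ_; _≤_ to _≤ℤ_)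
import Data.Integer.Properties as ℤ
open import Data.List using (List; []; _∷_)
import Data.List as List
import Data.List.Properties as List
open import Data.List.Relation.Unary.All using (All; []; _∷_)
open import Data.List.Relation.Unary.AllPairs using (AllPairs; []; _∷_)
open import Data.Nat using (ℕ; zero; suc; _≤_; _<_; _≤?_; _≤ᵇ_; _<ᵇ_; z≤n; s≤s; _+_; _*_; _∸_; ∣_-_∣)
import Data.Nat.ListAction as ListAction
open import Data.Nat.Properties as ℕ hiding (_≟_; _≤?_)
open import Data.Nat.Tactic.RingSolver using (solve-∀)
open import Data.Product using (_×_; _,_; Σ-syntax; ∃; ∃-syntax; proj₁; proj₂)
open import Data.Sum using (_⊎_; inj₁; inj₂; [_,_]′)
open import Data.Vec using (lookup; tabulate)
open import Data.Vec.Functional using (insertAt)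
open import Data.Vec.Functional.Properties using (insertAt-lookup; insertAt-punchIn)
open import Data.Vec.Properties using (lookup∘tabulate; tabulate∘lookup; []=⇒lookup; lookup⇒[]=)
open import Function using (_∘_)
open import Relation.Binary using (tri<; tri≈; tri>)
open import Relation.Binary.PropositionalEquality
open import Relation.Nullary using (¬_; Dec; yes; no)
open import Relation.Nullary.Decidable using (_×-dec_; _→-dec_; ¬?; map′; from-no; toWitness)
open import Algebra.Properties.CommutativeMonoid.Sum +-0-commutativeMonoid using (sum-cong-≗; sum-remove; ∑-distrib-+; ∑-comm) renaming (sum to ∑)

-- t is the slack; the identity is meant for the ring solver.
linear : ∀ {L R x y} t → x ≤ y → L + y + t ≡ R + x → L ≤ R
linear {L} {R} {x} {y} t x≤y eq = +-cancelʳ-≤ y L R (begin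
  L + y       ≤⟨ m≤m+n (L + y) t ⟩
  L + y + t   ≡⟨ eq ⟩
  R + x       ≤⟨ +-monoʳ-≤ R x≤y ⟩
  R + y       ∎)
  where open ≤-Reasoning

contradictory : ∀ {x y} t → x ≤ y → x ≡ suc (y + t) → ⊥
contradictory {x} {y} t x≤y eq = <-irrefl refl (≤-trans (s≤s (m≤m+n y t)) (≤-trans (≤-reflexive (sym eq)) x≤y))

-- Cardinalities of vertex sets as sums over the vertices

bit : Bool → ℕ
bit true  = 1
bit false = 0

∑-mono : ∀ {n} {f g : Fin n → ℕ} → (∀ v → f v ≤ g v) → ∑ f ≤ ∑ g
∑-mono {zero}  f≤g = z≤n
∑-mono {suc n} f≤g = +-mono-≤ (f≤g zero) (∑-mono (f≤g ∘ suc))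

∑-const : ∀ n c → ∑ {n} (λ _ → c) ≡ n * c
∑-const zero    c = refl
∑-const (suc n) c = cong (c +_) (∑-const n c)

∑-scale : ∀ {n} c (f : Fin n → ℕ) → ∑ (λ v → c * f v) ≡ c * ∑ f
∑-scale {zero}  c f = sym (*-zeroʳ c)
∑-scale {suc n} c f = trans (cong (c * f zero +_) (∑-scale c (f ∘ suc))) (sym (*-distribˡ-+ c (f zero) _))

-- Boolean predicates rather than `Subset`: the neighbourhood `adj G v` is then a vertex set as it
-- stands.
VertexSet : ℕ → Set
VertexSet n = Fin n → Bool

infixr 7 _∩_
infixr 6 _∪_ _∖_
_∩_ _∪_ _∖_ : ∀ {n} → VertexSet n → VertexSet n → VertexSet n
(S ∩ T) v = S v ∧ T v
(S ∪ T) v = S v ∨ T v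
(S ∖ T) v = S v ∧ not (T v)

full ∅ : ∀ {n} → VertexSet n
full _ = true
∅ _ = false

card : ∀ {n} → VertexSet n → ℕ
card S = ∑ (bit ∘ S)

infix 4 _⊆_
_⊆_ Disjoint : ∀ {n} → VertexSet n → VertexSet n → Set
S ⊆ T = ∀ v → S v ≡ true → T v ≡ true
Disjoint S T = ∀ v → S v ≡ true → T v ≡ true → ⊥

bits : ∀ {n} → List (VertexSet n) → Fin n → ℕ
bits []       v = 0
bits (S ∷ Ss) v = bit (S v) + bits Ss v

cards : ∀ {n} → List (VertexSet n) → ℕ
cards []       = 0
cards (S ∷ Ss) = card S + cards Ss

∑-bits : ∀ {n} (Ss : List (VertexSet n)) → ∑ (bits Ss) ≡ cards Ss
∑-bits {n} [] = trans (∑-const n 0) (*-zeroʳ n)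
∑-bits (S ∷ Ss) = trans (∑-distrib-+ (bit ∘ S) (bits Ss)) (cong (card S +_) (∑-bits Ss))

-- Every linear inequality between cardinalities is checked at a single vertex.
cards-mono : ∀ {n} (Ss Ts : List (VertexSet n)) → (∀ v → bits Ss v ≤ bits Ts v) → cards Ss ≤ cards Ts
cards-mono Ss Ts le = subst₂ _≤_ (∑-bits Ss) (∑-bits Ts) (∑-mono le)

card-cong : ∀ {n} {S T : VertexSet n} → (∀ v → S v ≡ T v) → card S ≡ card T
card-cong {n} S≗T = sum-cong-≗ {n} (cong bit ∘ S≗T)

card-full : ∀ n → card (full {n}) ≡ n
card-full n = trans (∑-const n 1) (*-identityʳ n)

card-∅ : ∀ n → card (∅ {n}) ≡ 0
card-∅ n = trans (∑-const n 0) (*-zeroʳ n)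

card-⊆ : ∀ {n} {S T : VertexSet n} → S ⊆ T → card S ≤ card T
card-⊆ {S = S} {T} S⊆T = ∑-mono (λ v → at (S v) (T v) (S⊆T v))
  where
  at : ∀ s t → (s ≡ true → t ≡ true) → bit s ≤ bit t
  at false t     h = z≤n
  at true  true  h = s≤s z≤n
  at true  false h with h refl
  ... | ()

⁅_⁆ : ∀ {n} → Fin n → VertexSet n
⁅ z ⁆ v with v ≟ z
... | yes _ = true
... | no  _ = false

⁅⁆-self : ∀ {n} (z : Fin n) → ⁅ z ⁆ z ≡ true
⁅⁆-self z with z ≟ z
... | yes _ = refl
... | no ne = ⊥-elim (ne refl)

⁅⁆-≢ : ∀ {n} {z v : Fin n} → v ≢ z → ⁅ z ⁆ v ≡ false
⁅⁆-≢ {z = z} {v} ne with v ≟ z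
... | yes e = ⊥-elim (ne e)
... | no _  = refl

⁅⁆⇒≡ : ∀ {n} {z v : Fin n} → ⁅ z ⁆ v ≡ true → v ≡ z
⁅⁆⇒≡ {z = z} {v} h with v ≟ z
... | yes e = e
... | no _ with h
... | ()

∑-single : ∀ {n} (z : Fin n) c → ∑ (λ v → bit (⁅ z ⁆ v) * c) ≡ c
∑-single {suc n} zero c = trans (cong₂ _+_ (+-identityʳ c) (trans (∑-const n 0) (*-zeroʳ n))) (+-identityʳ c)
∑-single {suc n} (suc z) c = trans (sum-cong-≗ {n} (λ v → cong (λ b → bit b * c) (shift v))) (∑-single z c)
  where
  shift : ∀ v → ⁅ suc z ⁆ (suc v) ≡ ⁅ z ⁆ v
  shift v with v ≟ z
  ... | yes _ = refl
  ... | no _  = refl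

card-⁅⁆ : ∀ {n} (z : Fin n) → card ⁅ z ⁆ ≡ 1
card-⁅⁆ {n} z = trans (sum-cong-≗ {n} (λ v → sym (*-identityʳ (bit (⁅ z ⁆ v))))) (∑-single z 1)

card-insert : ∀ {n} (S : VertexSet n) z → S z ≡ false → card (S ∪ ⁅ z ⁆) ≡ suc (card S)
card-insert {n} S z z∉S = trans (sum-cong-≗ {n} at) (trans (∑-distrib-+ (bit ∘ ⁅ z ⁆) (bit ∘ S)) (cong (_+ card S) (card-⁅⁆ z)))
  where
  at : ∀ v → bit ((S ∪ ⁅ z ⁆) v) ≡ bit (⁅ z ⁆ v) + bit (S v)
  at v with v ≟ z
  ... | no _ = cong bit (Bool.∨-identityʳ (S v))
  ... | yes refl rewrite z∉S = refl

∧-both : ∀ {x y} → x ≡ true → y ≡ true → x ∧ y ≡ true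
∧-both refl refl = refl

∧-left : ∀ {x y} → x ∧ y ≡ true → x ≡ true
∧-left {true} _ = refl

∧-right : ∀ {x y} → x ∧ y ≡ true → y ≡ true
∧-right {true} h = h

∨-cases : ∀ {x y} → x ∨ y ≡ true → x ≡ true ⊎ y ≡ true
∨-cases {true}  _ = inj₁ refl
∨-cases {false} h = inj₂ h

∨-left : ∀ {x y} → x ≡ true → x ∨ y ≡ true
∨-left refl = refl

∨-right : ∀ {x y} → y ≡ true → x ∨ y ≡ true
∨-right {true}  _ = refl
∨-right {false} h = h

not-true : ∀ {x} → not x ≡ true → x ≡ true → ⊥
not-true {true} () _
not-true {false} _ ()

true? : ∀ (x : Bool) → Dec (x ≡ true)
true? true  = yes refl
true? false = no λ ()

≢true : ∀ {x} → ¬ x ≡ true → x ≡ false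
≢true {true}  h = ⊥-elim (h refl)
≢true {false} _ = refl

false≢true : ∀ {x} → x ≡ false → x ≡ true → ⊥
false≢true refl ()

∉-disjoint : ∀ {n} {S T : VertexSet n} → Disjoint S T → ∀ {v} → S v ≡ true → T v ≡ false
∉-disjoint dis {v} Sv = ≢true (dis v Sv)

∖-∈ : ∀ {n} {S T : VertexSet n} {v} → S v ≡ true → T v ≡ false → (S ∖ T) v ≡ true
∖-∈ Sv Tv = ∧-both Sv (cong not Tv)

member : ∀ {n} (S : VertexSet n) → 0 < card S → ∃[ v ] S v ≡ true
member {n} S 0<S with any? (λ v → true? (S v))
... | yes h = h
... | no h  = ⊥-elim (<-irrefl (sym (trans (card-cong {T = ∅} (λ v → ≢true (λ e → h (v , e)))) (card-∅ n))) 0<S)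

larger-member : ∀ {n} (S T : VertexSet n) → card T < card S → ∃[ v ] (S v ≡ true × T v ≡ false)
larger-member S T lt with any? (λ v → true? ((S ∖ T) v))
... | yes (v , h) = v , ∧-left h , ≢true (not-true (∧-right {S v} h))
... | no h = ⊥-elim (<-irrefl refl (<-≤-trans lt (card-⊆ {S = S} {T} inT)))
  where
  inT : S ⊆ T
  inT v Sv with true? (T v)
  ... | yes e = e
  ... | no e = ⊥-elim (h (v , ∖-∈ {S = S} {T} Sv (≢true e)))

subset-of-size : ∀ {n} t (S : VertexSet n) → t ≤ card S → ∃[ T ] (T ⊆ S × card T ≡ t)
subset-of-size {n} zero S _ = ∅ , (λ _ ()) , card-∅ n
subset-of-size (suc t) S t<S with subset-of-size t S (<⇒≤ t<S)
... | T , T⊆S , refl with larger-member S T t<S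
... | z , Sz , Tz = T ∪ ⁅ z ⁆ , sub , card-insert T z Tz
  where
  sub : T ∪ ⁅ z ⁆ ⊆ S
  sub v h with ∨-cases {T v} h
  ... | inj₁ Tv = T⊆S v Tv
  ... | inj₂ e rewrite ⁅⁆⇒≡ {z = z} {v} e = Sz

-- The search runs over vectors, and `lookup (tabulate S)` agrees with `S` only pointwise; `P-cong`
-- bridges the gap.
search : ∀ {n} (P : VertexSet n → Set) → (∀ S → Dec (P S)) →
  (∀ {S T} → (∀ v → S v ≡ T v) → P S → P T) → Dec (∃ P)
search P P? P-cong = map′ (λ (S , h) → lookup S , h)
  (λ (S , h) → tabulate S , P-cong (λ v → sym (lookup∘tabulate S v)) h)
  (anySubset? (λ S → P? (lookup S)))

-- Zykov symmetrisation towards a set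

Indep : ∀ {n} → SimpleGraph n → VertexSet n → Set
Indep G S = ∀ i j → S i ≡ true → S j ≡ true → Adj G i j → ⊥

deg : ∀ {n} → SimpleGraph n → Fin n → ℕ
deg G v = card (adj G v)

degsum : ∀ {n} → SimpleGraph n → ℕ
degsum G = ∑ (deg G)

record Admissible {n} (G : SimpleGraph n) (s : ℕ) : Set where
  field
    triangleFree : TriangleFree G
    indep≤       : ∀ S → Indep G S → card S ≤ s
open Admissible

Adj-sym : ∀ {n} (G : SimpleGraph n) {v w} → Adj G v w → Adj G w v
Adj-sym G {v} {w} vw = trans (SimpleGraph.sym G w v) vw

Adj-irrefl : ∀ {n} (G : SimpleGraph n) {v} → Adj G v v → ⊥
Adj-irrefl G {v} vv = false≢true (irrefl G v) vv

nbhd-indep : ∀ {n s} {G : SimpleGraph n} → Admissible G s → ∀ v → Indep G (adj G v)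
nbhd-indep ok v i j vi vj ij = triangleFree ok v i j vi ij vj

deg≤ : ∀ {n s} {G : SimpleGraph n} → Admissible G s → ∀ v → deg G v ≤ s
deg≤ {G = G} ok v = indep≤ ok (adj G v) (nbhd-indep ok v)

degsum≤ : ∀ {n s} {G : SimpleGraph n} → Admissible G s → degsum G ≤ n * s
degsum≤ {n} {s} {G} ok = ≤-trans (∑-mono (deg≤ ok)) (≤-reflexive (∑-const n s))

Indep-cong : ∀ {n} {G : SimpleGraph n} {S T} → (∀ v → S v ≡ T v) → Indep G S → Indep G T
Indep-cong eq ind i j Ti Tj = ind i j (trans (eq i) Ti) (trans (eq j) Tj)

indep? : ∀ {n} (G : SimpleGraph n) S → Dec (Indep G S)
indep? G S = all? λ i → all? λ j → true? (S i) →-dec (true? (S j) →-dec ¬? (true? (adj G i j)))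

Indep-∪ : ∀ {n} {G : SimpleGraph n} {S T} → Indep G S → Indep G T →
  (∀ i j → S i ≡ true → T j ≡ true → Adj G i j → ⊥) → Indep G (S ∪ T)
Indep-∪ {G = G} {S} {T} indS indT cross i j Hi Hj ij with ∨-cases {S i} Hi | ∨-cases {S j} Hj
... | inj₁ Si | inj₁ Sj = indS i j Si Sj ij
... | inj₁ Si | inj₂ Tj = cross i j Si Tj ij
... | inj₂ Ti | inj₁ Sj = cross j i Sj Ti (Adj-sym G ij)
... | inj₂ Ti | inj₂ Tj = indT i j Ti Tj ij

_≡⊎≢_ : ∀ {n} (v z : Fin n) → v ≡ z ⊎ v ≢ z
v ≡⊎≢ z with v ≟ z
... | yes e = inj₁ e
... | no ne = inj₂ ne

redirected : ∀ {n} → SimpleGraph n → VertexSet n → Fin n → Fin n → Fin n → Bool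
redirected G X z i j with i ≟ z | j ≟ z
... | yes _ | _     = X j
... | no _  | yes _ = X i
... | no _  | no _  = adj G i j

redirected-from : ∀ {n} (G : SimpleGraph n) X z j → redirected G X z z j ≡ X j
redirected-from G X z j with z ≟ z
... | yes _ = refl
... | no ne = ⊥-elim (ne refl)

redirected-to : ∀ {n} (G : SimpleGraph n) X z i → redirected G X z i z ≡ X i
redirected-to G X z i with i ≟ z | z ≟ z
... | yes refl | _  = refl
... | no _ | yes _  = refl
... | no _ | no ne  = ⊥-elim (ne refl)

redirected-other : ∀ {n} (G : SimpleGraph n) X z {i j} → i ≢ z → j ≢ z → redirected G X z i j ≡ adj G i j
redirected-other G X z {i} {j} i≢z j≢z with i ≟ z | j ≟ z
... | yes e | _     = ⊥-elim (i≢z e)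
... | no _  | yes e = ⊥-elim (j≢z e)
... | no _  | no _  = refl

redirect : ∀ {n} (G : SimpleGraph n) (X : VertexSet n) (z : Fin n) → X z ≡ false → SimpleGraph n
redirect G X z z∉X = record { adj = redirected G X z ; sym = symm ; irrefl = irr }
  where
  symm : ∀ i j → redirected G X z i j ≡ redirected G X z j i
  symm i j with i ≟ z | j ≟ z
  ... | yes refl | yes refl = refl
  ... | yes _ | no _  = refl
  ... | no _  | yes _ = refl
  ... | no _  | no _  = SimpleGraph.sym G i j
  irr : ∀ i → redirected G X z i i ≡ false
  irr i with i ≟ z
  ... | yes refl = z∉X
  ... | no _ = irrefl G i

redirect-indep : ∀ {n} {G : SimpleGraph n} {X z} (z∉X : X z ≡ false) {S} → Indep G S →
  S z ≡ false ⊎ Disjoint S X → Indep (redirect G X z z∉X) S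
redirect-indep {G = G} {X} {z} z∉X {S} ind away i j Si Sj ij with i ≟ z | j ≟ z | away
... | yes refl | _ | inj₁ Sz = false≢true Sz Si
... | yes _ | _ | inj₂ dis = dis j Sj ij
... | no _ | yes refl | inj₁ Sz = false≢true Sz Sj
... | no _ | yes _ | inj₂ dis = dis i Si ij
... | no _ | no _ | _ = ind i j Si Sj ij

redirect-old : ∀ {n} {G : SimpleGraph n} {X z} (z∉X : X z ≡ false) {S} → S z ≡ false →
  Indep (redirect G X z z∉X) S → Indep G S
redirect-old {G = G} {X} {z} z∉X {S} Sz ind i j Si Sj ij =
  ind i j Si Sj (trans (redirected-other G X z (off i Si) (off j Sj)) ij)
  where
  off : ∀ v → S v ≡ true → v ≢ z
  off v Sv refl = false≢true Sz Sv

-- An independent set of the new graph that contains `z` avoids `X`. Without `z` it is independent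
-- in `G`, and it then has fewer than `s` vertices, for otherwise `forced` would put `z` into it.
redirect-admissible : ∀ {n s} {G : SimpleGraph n} {X z} (z∉X : X z ≡ false) → Admissible G s → Indep G X →
  (∀ F → Indep G F → card F ≡ s → Disjoint F X → F z ≡ true) → Admissible (redirect G X z z∉X) s
redirect-admissible {n} {s} {G} {X} {z} z∉X ok indX forced = record { triangleFree = tf ; indep≤ = bound }
  where
  G' = redirect G X z z∉X
  off : ∀ {v} → X v ≡ true → v ≢ z
  off Xv refl = false≢true z∉X Xv
  -- a triangle through z would contain an edge inside X
  through : ∀ j k → Adj G' z j → Adj G' z k → Adj G' j k → ⊥
  through j k zj zk jk = indX j k Xj Xk (trans (sym (redirected-other G X z (off Xj) (off Xk))) jk)
    where
    Xj = trans (sym (redirected-from G X z j)) zj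
    Xk = trans (sym (redirected-from G X z k)) zk
  tf : TriangleFree G'
  tf i j k ij jk ik with i ≡⊎≢ z | j ≡⊎≢ z | k ≡⊎≢ z
  ... | inj₁ refl | _ | _ = through j k ij ik jk
  ... | inj₂ _ | inj₁ refl | _ = through i k (Adj-sym G' {i} {j} ij) jk ik
  ... | inj₂ _ | inj₂ _ | inj₁ refl = through i j (Adj-sym G' {i} {k} ik) (Adj-sym G' {j} {k} jk) ij
  ... | inj₂ i≢z | inj₂ j≢z | inj₂ k≢z = triangleFree ok i j k (old i≢z j≢z ij) (old j≢z k≢z jk) (old i≢z k≢z ik)
    where
    old : ∀ {v w} → v ≢ z → w ≢ z → Adj G' v w → Adj G v w
    old v≢z w≢z vw = trans (sym (redirected-other G X z v≢z w≢z)) vw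
  bound : ∀ S → Indep G' S → card S ≤ s
  bound S ind with true? (S z)
  ... | no Sz = indep≤ ok S (redirect-old z∉X (≢true Sz) ind)
  ... | yes Sz = subst (_≤ s) (sym size) (≤∧≢⇒< (indep≤ ok F indF) notFull)
    where
    F = S ∖ ⁅ z ⁆
    Fz : F z ≡ false
    Fz = trans (cong (λ b → S z ∧ not b) (⁅⁆-self z)) (Bool.∧-zeroʳ (S z))
    indF : Indep G F
    indF = redirect-old z∉X Fz (λ i j Fi Fj → ind i j (∧-left Fi) (∧-left Fj))
    notFull : card F ≢ s
    notFull e = false≢true Fz (forced F indF e
      (λ v Fv Xv → ind z v Sz (∧-left Fv) (trans (redirected-from G X z v) Xv)))
    size : card S ≡ suc (card F)
    size = trans (card-cong at) (card-insert F z Fz)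
      where
      at : ∀ v → S v ≡ (F ∪ ⁅ z ⁆) v
      at v with v ≟ z
      ... | yes refl = trans Sz (sym (Bool.∨-zeroʳ (S v ∧ false)))
      ... | no _ = sym (trans (Bool.∨-identityʳ (S v ∧ true)) (Bool.∧-identityʳ (S v)))

-- Stated additively to avoid truncated subtraction: `z` trades `deg G z` for `card X`, every other
-- vertex trades its edge to `z` for membership in `X`.
redirect-deg : ∀ {n} (G : SimpleGraph n) X z (z∉X : X z ≡ false) v →
  deg (redirect G X z z∉X) v + (bit (adj G z v) + bit (⁅ z ⁆ v) * deg G z) ≡
  deg G v + (bit (X v) + bit (⁅ z ⁆ v) * card X)
redirect-deg {n} G X z z∉X v with v ≡⊎≢ z
... | inj₁ refl rewrite irrefl G v | z∉X | ⁅⁆-self v =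
  trans (cong (_+ (deg G v + 0)) (sum-cong-≗ {n} (λ j → cong bit (redirected-from G X v j)))) (swap (card X) (deg G v))
  where
  swap : ∀ x y → x + (y + 0) ≡ y + (x + 0)
  swap = solve-∀
... | inj₂ v≢z rewrite ⁅⁆-≢ v≢z | SimpleGraph.sym G z v | +-identityʳ (bit (adj G v z)) | +-identityʳ (bit (X v)) = begin
  deg G' v + bit (adj G v z)
    ≡⟨ cong (deg G' v +_) (sym (∑-single z _)) ⟩
  deg G' v + ∑ (λ j → bit (⁅ z ⁆ j) * bit (adj G v z))
    ≡⟨ sym (∑-distrib-+ (bit ∘ adj G' v) _) ⟩
  ∑ (λ j → bit (adj G' v j) + bit (⁅ z ⁆ j) * bit (adj G v z))
    ≡⟨ sum-cong-≗ {n} at ⟩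
  ∑ (λ j → bit (adj G v j) + bit (⁅ z ⁆ j) * bit (X v))
    ≡⟨ ∑-distrib-+ (bit ∘ adj G v) _ ⟩
  deg G v + ∑ (λ j → bit (⁅ z ⁆ j) * bit (X v))
    ≡⟨ cong (deg G v +_) (∑-single z _) ⟩
  deg G v + bit (X v) ∎
  where
  open ≡-Reasoning
  G' = redirect G X z z∉X
  swap : ∀ x y → x + (y + 0) ≡ y + (x + 0)
  swap = solve-∀
  at : ∀ j → bit (adj G' v j) + bit (⁅ z ⁆ j) * bit (adj G v z) ≡ bit (adj G v j) + bit (⁅ z ⁆ j) * bit (X v)
  at j with j ≡⊎≢ z
  ... | inj₁ refl rewrite ⁅⁆-self j | redirected-to G X j v = swap (bit (X v)) (bit (adj G v j))
  ... | inj₂ j≢z rewrite ⁅⁆-≢ j≢z | redirected-other G X z v≢z j≢z = refl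

-- Both the row and the column of `z` change, so the total changes by `2 * (card X - deg G z)`.
redirect-degsum : ∀ {n} (G : SimpleGraph n) X z (z∉X : X z ≡ false) → deg G z ≤ card X →
  degsum G ≤ degsum (redirect G X z z∉X)
redirect-degsum {n} G X z z∉X dz≤X = linear 0 (+-mono-≤ dz≤X dz≤X)
  (trans (+-identityʳ (degsum G + (card X + card X))) (sym total))
  where
  G' = redirect G X z z∉X
  expand : ∀ (f g : Fin n → ℕ) c → ∑ (λ v → f v + (g v + bit (⁅ z ⁆ v) * c)) ≡ ∑ f + (∑ g + c)
  expand f g c = trans (∑-distrib-+ f _) (cong (∑ f +_) (trans (∑-distrib-+ g _) (cong (∑ g +_) (∑-single z c))))
  total : degsum G' + (deg G z + deg G z) ≡ degsum G + (card X + card X)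
  total = trans (sym (expand (deg G') (bit ∘ adj G z) (deg G z)))
    (trans (sum-cong-≗ {n} (redirect-deg G X z z∉X)) (expand (deg G) (bit ∘ X) (card X)))

-- Classes of vertices with a prescribed neighbourhood

record Class {n} (G : SimpleGraph n) (K X : VertexSet n) : Set where
  constructor class
  field nbhd : ∀ v w → K v ≡ true → adj G v w ≡ X w
open Class

SizedIndep : ∀ {n} → SimpleGraph n → ℕ → VertexSet n → Set
SizedIndep G s S = Indep G S × card S ≡ s

class-disjoint : ∀ {n} {G : SimpleGraph n} {K X} → Class G K X → Disjoint K X
class-disjoint {G = G} c v Kv Xv = Adj-irrefl G (trans (nbhd c v v Kv) Xv)

class-⊆ : ∀ {n} {G : SimpleGraph n} {K L X} → K ⊆ L → Class G L X → Class G K X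
class-⊆ K⊆L c = class λ v w Kv → nbhd c v w (K⊆L v Kv)

class-indep : ∀ {n} {G : SimpleGraph n} {K X} → Class G K X → Indep G K
class-indep c i j Ki Kj ij = class-disjoint c j Kj (trans (sym (nbhd c i j Ki)) ij)

class-∪-indep : ∀ {n} {G : SimpleGraph n} {K X S} → Class G K X → Indep G S → Disjoint S X → Indep G (S ∪ K)
class-∪-indep {G = G} c ind dis = Indep-∪ {G = G} ind (class-indep {G = G} c)
  (λ i j Si Kj ij → dis i Si (trans (sym (nbhd c j i Kj)) (Adj-sym G ij)))

-- In the new graph a vertex `v` of `K` is joined to `z` exactly when `X v`, whereas the class
-- demands `Y z`; all other pairs at `K` are unchanged.
class-redirect : ∀ {n} {G : SimpleGraph n} {K Y X z} (z∉X : X z ≡ false) → Class G K Y → K z ≡ false →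
  (∀ v → K v ≡ true → X v ≡ Y z) → Class (redirect G X z z∉X) K Y
class-redirect {G = G} {K} {Y} {X} {z} z∉X c Kz agree = class at
  where
  at : ∀ v w → K v ≡ true → redirected G X z v w ≡ Y w
  at v w Kv with w ≡⊎≢ z
  ... | inj₁ refl = trans (redirected-to G X z v) (agree v Kv)
  ... | inj₂ w≢z = trans (redirected-other G X z (λ { refl → false≢true Kz Kv }) w≢z) (nbhd c v w Kv)

class-insert : ∀ {n} {G : SimpleGraph n} {K X z} (z∉X : X z ≡ false) → Class G K X →
  Class (redirect G X z z∉X) (K ∪ ⁅ z ⁆) X
class-insert {G = G} {K} {X} {z} z∉X c = class at
  where
  at : ∀ v w → K v ∨ ⁅ z ⁆ v ≡ true → redirected G X z v w ≡ X w
  at v w h with v ≡⊎≢ z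
  ... | inj₁ refl = redirected-from G X z w
  ... | inj₂ v≢z with w ≡⊎≢ z
  -- Old members of `K` avoid `X`, so none of them becomes a neighbour of `z`.
  ... | inj₁ refl = trans (redirected-to G X z v) (trans (≢true (λ Xv → class-disjoint c v Kv Xv)) (sym z∉X))
    where
    Kv : K v ≡ true
    Kv = trans (sym (trans (cong (K v ∨_) (⁅⁆-≢ v≢z)) (Bool.∨-identityʳ (K v)))) h
  ... | inj₂ w≢z = trans (redirected-other G X z v≢z w≢z) (nbhd c v w Kv)
    where
    Kv : K v ≡ true
    Kv = trans (sym (trans (cong (K v ∨_) (⁅⁆-≢ v≢z)) (Bool.∨-identityʳ (K v)))) h

card-∪-disjoint : ∀ {n} (S T : VertexSet n) → Disjoint S T → card S + card T ≤ card (S ∪ T)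
card-∪-disjoint S T dis = subst₂ _≤_ (cong (card S +_) (+-identityʳ _)) (+-identityʳ _)
  (cards-mono (S ∷ T ∷ []) (S ∪ T ∷ []) (λ v → at (S v) (T v) (dis v)))
  where
  at : ∀ s t → (s ≡ true → t ≡ true → ⊥) → bit s + (bit t + 0) ≤ bit (s ∨ t) + 0
  at true  true  h = ⊥-elim (h refl refl)
  at true  false h = ≤-refl
  at false t     h = ≤-refl

card-∖-∩ : ∀ {n} (S T : VertexSet n) → card S ≤ card (S ∖ T) + card (S ∩ T)
card-∖-∩ S T = subst₂ _≤_ (+-identityʳ _) (cong (card (S ∖ T) +_) (+-identityʳ _))
  (cards-mono (S ∷ []) (S ∖ T ∷ S ∩ T ∷ []) (λ v → at (S v) (T v)))
  where
  at : ∀ s t → bit s + 0 ≤ bit (s ∧ not t) + (bit (s ∧ t) + 0)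
  at true  true  = ≤-refl
  at true  false = ≤-refl
  at false t     = z≤n

card-∩-∪ : ∀ {n} (S T : VertexSet n) → card S + card T ≤ card (S ∩ T) + card (S ∪ T)
card-∩-∪ S T = subst₂ _≤_ (cong (card S +_) (+-identityʳ _)) (cong (card (S ∩ T) +_) (+-identityʳ _))
  (cards-mono (S ∷ T ∷ []) (S ∩ T ∷ S ∪ T ∷ []) (λ v → at (S v) (T v)))
  where
  at : ∀ s t → bit s + (bit t + 0) ≤ bit (s ∧ t) + (bit (s ∨ t) + 0)
  at true  true  = ≤-refl
  at true  false = ≤-refl
  at false t     = ≤-refl

card≤n : ∀ {n} (S : VertexSet n) → card S ≤ n
card≤n {n} S = subst (card S ≤_) (card-full n) (card-⊆ {S = S} {full} (λ _ _ → refl))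

-- K can replace F ∩ X in F.
class-exchange : ∀ {n s} {G : SimpleGraph n} {K X F} → Admissible G s → Class G K X → Indep G F → Disjoint F K →
  card (F ∖ X) + card K ≤ s
class-exchange {G = G} {K} {X} {F} ok c ind dis = ≤-trans
  (card-∪-disjoint (F ∖ X) K (λ v h → dis v (∧-left h)))
  (indep≤ ok _ (class-∪-indep c (λ i j Fi Fj → ind i j (∧-left Fi) (∧-left Fj)) (λ v h → not-true (∧-right {F v} h))))

-- All neighbours of `K` lie in `X`, so `F ∪ K` is independent, and `F` already has the largest
-- possible size.
class-absorbed : ∀ {n s} {G : SimpleGraph n} {K X F} → Admissible G s → Class G K X → SizedIndep G s F →
  Disjoint F X → K ⊆ F
class-absorbed {s = s} {K = K} {F = F} ok c (ind , size) dis v Kv with true? (F v)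
... | yes Fv = Fv
... | no Fv = ⊥-elim (<-irrefl refl (<-≤-trans (≤-reflexive (cong suc (sym size)))
  (≤-trans (≤-reflexive (sym (card-insert F v (≢true Fv))))
    (≤-trans (card-⊆ {S = F ∪ ⁅ v ⁆} {F ∪ K} sub) (indep≤ ok _ (class-∪-indep c ind dis))))))
  where
  sub : F ∪ ⁅ v ⁆ ⊆ F ∪ K
  sub w h with ∨-cases {F w} h
  ... | inj₁ Fw = ∨-left Fw
  ... | inj₂ e rewrite ⁅⁆⇒≡ {z = v} {w} e = ∨-right {F v} Kv

-- Together with `class-absorbed`: an independent `s`-set that meets `K` contains all of `K`.
meets⇒disjoint : ∀ {n} {G : SimpleGraph n} {K X F v} → Class G K X → Indep G F → K v ≡ true → F v ≡ true →
  Disjoint F X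
meets⇒disjoint {v = v} c ind Kv Fv w Fw Xw = ind v w Fv Fw (trans (nbhd c v w Kv) Xw)

-- Forced vertices, growth of classes and partners of a set

Forced : ∀ {n} → SimpleGraph n → ℕ → VertexSet n → Fin n → Set
Forced G s X z = ∀ F → Indep G F → card F ≡ s → Disjoint F X → F z ≡ true

-- A family of maximum independent sets satisfies |⋂| + |⋃| ≥ 2s; I and U play the roles of ⋂ and ⋃.
forced-vertex : ∀ {n s} {G : SimpleGraph n} → Admissible G s → (X Y₁ Y₂ Z : VertexSet n) →
  Indep G Y₁ → Indep G Y₂ → Disjoint Y₁ X → Disjoint Y₂ X → card Z + n < card Y₁ + card Y₂ + card X →
  ∃[ z ] (Y₁ z ≡ true × Y₂ z ≡ true × Z z ≡ false × Forced G s X z)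
forced-vertex {n} {s} {G} ok X Y₁ Y₂ Z ind₁ ind₂ dis₁ dis₂ large = result
  where
  P : Fin n → VertexSet n → Set
  P z F = Indep G F × card F ≡ s × Disjoint F X × F z ≡ false
  P? : ∀ z F → Dec (P z F)
  P? z F = indep? G F ×-dec ((card F ℕ.≟ s) ×-dec
    ((all? λ v → true? (F v) →-dec ¬? (true? (X v))) ×-dec (F z Bool.≟ false)))
  P-cong : ∀ z {S T} → (∀ v → S v ≡ T v) → P z S → P z T
  P-cong z eq (ind , size , dis , Sz) = Indep-cong {G = G} eq ind , trans (sym (card-cong eq)) size ,
    (λ v Tv → dis v (trans (eq v) Tv)) , trans (sym (eq z)) Sz

  -- Since `U` avoids `X`, it has at most `n - card X` vertices, so the last hypothesis leaves `I`
  -- larger than `Z`. Only the total size of `Y₁` and `Y₂` enters, so neither has to be an `s`-set.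
  loop : ∀ fuel I U → card I ≤ fuel → I ⊆ U → (∀ i j → I i ≡ true → U j ≡ true → Adj G i j → ⊥) → Disjoint U X →
    card Z + n < card I + card U + card X →
    ∃[ z ] (I z ≡ true × Z z ≡ false × Forced G s X z)
  loop fuel I U I≤fuel I⊆U apart disU large with larger-member I Z Z<I
    where
    Z<I : card Z < card I
    Z<I = linear 0 (+-mono-≤ large (≤-trans (card-∪-disjoint U X disU) (card≤n (U ∪ X))))
      (arith (card Z) (card I) (card U) (card X) n)
      where
      arith : ∀ z i u x n → suc z + (i + u + x + n) + 0 ≡ i + (suc (z + n) + (u + x))
      arith = solve-∀
  ... | z , Iz , Zz with search (P z) (P? z) (P-cong z)
  ... | no none = z , Iz , Zz , λ F ind size dis → Bool.¬-not (λ Fz → none (F , ind , size , dis , Fz))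
  loop zero I U I≤fuel _ _ _ _ | z , Iz , _ | yes _ =
    ⊥-elim (<-irrefl refl (<-≤-trans (s≤s z≤n) (≤-trans (≤-reflexive (sym (card-⁅⁆ z)))
      (≤-trans (card-⊆ {S = ⁅ z ⁆} {I} (λ v h → subst (λ w → I w ≡ true) (sym (⁅⁆⇒≡ {z = z} {v} h)) Iz)) I≤fuel))))
  loop (suc fuel) I U I≤fuel I⊆U apart disU large | z , Iz , Zz | yes (F , ind , size , dis , Fz)
    with loop fuel (I ∩ F) (U ∪ F) smaller (λ v h → ∨-left (I⊆U v (∧-left h))) apart' disU' large'
    where
    smaller : card (I ∩ F) ≤ fuel
    smaller = ≤-pred (≤-trans (≤-reflexive (sym (card-insert (I ∩ F) z (trans (cong (I z ∧_) Fz) (Bool.∧-zeroʳ (I z))))))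
      (≤-trans (card-⊆ {S = (I ∩ F) ∪ ⁅ z ⁆} {I} sub) I≤fuel))
      where
      sub : (I ∩ F) ∪ ⁅ z ⁆ ⊆ I
      sub v h with ∨-cases {I v ∧ F v} h
      ... | inj₁ IF = ∧-left IF
      ... | inj₂ e rewrite ⁅⁆⇒≡ {z = z} {v} e = Iz
    apart' : ∀ i j → I i ∧ F i ≡ true → U j ∨ F j ≡ true → Adj G i j → ⊥
    apart' i j IFi h with ∨-cases {U j} h
    ... | inj₁ Uj = apart i j (∧-left IFi) Uj
    ... | inj₂ Fj = ind i j (∧-right {I i} IFi) Fj
    disU' : Disjoint (U ∪ F) X
    disU' v h with ∨-cases {U v} h
    ... | inj₁ Uv = disU v Uv
    ... | inj₂ Fv = dis v Fv
    -- No edges join `I` to `U`, so this set is independent and has at most `s = card F` vertices.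
    -- The count balances at every vertex, hence passing to `I ∩ F` and `U ∪ F` does not lower the
    -- total size.
    S = (I ∖ F) ∪ (F ∩ U)
    indS : Indep G S
    indS = Indep-∪ {G = G} {I ∖ F} {F ∩ U}
      (λ i j Ii Ij → apart i j (∧-left Ii) (I⊆U j (∧-left Ij)))
      (λ i j Fi Fj → ind i j (∧-left Fi) (∧-left Fj))
      (λ i j Ii Fj → apart i j (∧-left Ii) (∧-right {F j} Fj))
    count : card I + (card U + (card F + 0)) ≤ card (I ∩ F) + (card (U ∪ F) + (card S + 0))
    count = cards-mono (I ∷ U ∷ F ∷ []) (I ∩ F ∷ U ∪ F ∷ S ∷ []) (λ v → at (I v) (U v) (F v))
      where
      at : ∀ i u f → bit i + (bit u + (bit f + 0)) ≤ bit (i ∧ f) + (bit (u ∨ f) + (bit ((i ∧ not f) ∨ (f ∧ u)) + 0))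
      at true true true = ≤-refl
      at true true false = ≤-refl
      at true false true = ≤-refl
      at true false false = ≤-refl
      at false true true = ≤-refl
      at false true false = ≤-refl
      at false false true = ≤-refl
      at false false false = ≤-refl
    large' : card Z + n < card (I ∩ F) + card (U ∪ F) + card X
    large' = linear 0 (+-mono-≤ large (+-mono-≤ count (≤-trans (indep≤ ok S indS) (≤-reflexive (sym size)))))
      (arith (card Z) n (card I) (card U) (card X) (card F) (card (I ∩ F)) (card (U ∪ F)) (card S))
      where
      arith : ∀ z n i u x f i' u' s → suc (z + n) + (i + u + x + (i' + (u' + (s + 0)) + f)) + 0 ≡
        i' + u' + x + (suc (z + n) + (i + (u + (f + 0)) + s))
      arith = solve-∀
  ... | z' , IFz' , Zz' , forced = z' , ∧-left IFz' , Zz' , forced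

  apart : ∀ i j → Y₁ i ∧ Y₂ i ≡ true → Y₁ j ∨ Y₂ j ≡ true → Adj G i j → ⊥
  apart i j both h with ∨-cases {Y₁ j} h
  ... | inj₁ h₁ = ind₁ i j (∧-left both) h₁
  ... | inj₂ h₂ = ind₂ i j (∧-right {Y₁ i} both) h₂
  disU : Disjoint (Y₁ ∪ Y₂) X
  disU v h with ∨-cases {Y₁ v} h
  ... | inj₁ h₁ = dis₁ v h₁
  ... | inj₂ h₂ = dis₂ v h₂
  split : ∃[ z ] (Y₁ z ∧ Y₂ z ≡ true × Z z ≡ false × Forced G s X z) →
    ∃[ z ] (Y₁ z ≡ true × Y₂ z ≡ true × Z z ≡ false × Forced G s X z)
  split (z , both , Zz , forced) = z , ∧-left both , ∧-right {Y₁ z} both , Zz , forced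
  result : ∃[ z ] (Y₁ z ≡ true × Y₂ z ≡ true × Z z ≡ false × Forced G s X z)
  result = split (loop (card (Y₁ ∩ Y₂)) (Y₁ ∩ Y₂) (Y₁ ∪ Y₂) ≤-refl (λ v h → ∨-left {Y₁ v} {Y₂ v} (∧-left {Y₁ v} {Y₂ v} h))
    apart disU (<-≤-trans large (+-monoˡ-≤ (card X) (card-∩-∪ Y₁ Y₂))))

-- Each round applies `forced-vertex` with the class built so far as the excluded set, so the
-- redirected vertex is new. With three `s`-sets the room is `t = 3 * s - n`. The degree condition
-- is automatic when `card X = s`; it matters when `X` is the smaller set `E`.
fill : ∀ {n s} (Inv : SimpleGraph n → Set) (X Y₁ Y₂ : VertexSet n) →
  (∀ {G} → Inv G → Indep G X × Indep G Y₁ × Indep G Y₂) → Disjoint Y₁ X → Disjoint Y₂ X →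
  (∀ {G} → Admissible G s → Inv G → ∀ z → Y₁ z ≡ true → Y₂ z ≡ true → deg G z ≤ card X) →
  (∀ {G} z (z∉X : X z ≡ false) → Inv G → Y₁ z ≡ true → Y₂ z ≡ true → Inv (redirect G X z z∉X)) →
  ∀ t {G} → t + n ≤ card Y₁ + card Y₂ + card X → Admissible G s → Inv G →
  ∃[ G' ] ∃[ K ] (Admissible G' s × Inv G' × degsum G ≤ degsum G' × Class G' K X × K ⊆ Y₁ × K ⊆ Y₂ × card K ≡ t)
fill {n} Inv X Y₁ Y₂ parts dis₁ dis₂ degX pres zero {G} _ ok inv =
  G , ∅ , ok , inv , ≤-refl , class (λ _ _ ()) , (λ _ ()) , (λ _ ()) , card-∅ n
fill {n} {s} Inv X Y₁ Y₂ parts dis₁ dis₂ degX pres (suc t) {G₀} room ok₀ inv₀ =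
  extend (fill Inv X Y₁ Y₂ parts dis₁ dis₂ degX pres t (<⇒≤ room) ok₀ inv₀)
  where
  Filled : ℕ → SimpleGraph n → VertexSet n → Set
  Filled t G K = Admissible G s × Inv G × degsum G₀ ≤ degsum G × Class G K X × K ⊆ Y₁ × K ⊆ Y₂ × card K ≡ t
  extend : (∃[ G ] ∃[ K ] Filled t G K) → ∃[ G ] ∃[ K ] Filled (suc t) G K
  extend (G , K , ok , inv , up , cl , K₁ , K₂ , size) =
    step (forced-vertex ok X Y₁ Y₂ K (proj₁ (proj₂ (parts inv))) (proj₂ (proj₂ (parts inv))) dis₁ dis₂
      (subst (λ k → k + n < card Y₁ + card Y₂ + card X) (sym size) room))
    where
    step : ∃[ z ] (Y₁ z ≡ true × Y₂ z ≡ true × K z ≡ false × Forced G s X z) → ∃[ G ] ∃[ K ] Filled (suc t) G K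
    step (z , Y₁z , Y₂z , Kz , forced) = redirect G X z z∉X , K ∪ ⁅ z ⁆ ,
      redirect-admissible z∉X ok (proj₁ (parts inv)) forced , pres z z∉X inv Y₁z Y₂z ,
      ≤-trans up (redirect-degsum G X z z∉X (degX ok inv z Y₁z Y₂z)) , class-insert z∉X cl ,
      into Y₁ Y₁z K₁ , into Y₂ Y₂z K₂ , trans (card-insert K z Kz) (cong suc size)
      where
      z∉X : X z ≡ false
      z∉X = ∉-disjoint {S = Y₁} {X} dis₁ Y₁z
      into : ∀ Y → Y z ≡ true → K ⊆ Y → K ∪ ⁅ z ⁆ ⊆ Y
      into Y Yz K⊆Y v h with ∨-cases {K v} h
      ... | inj₁ Kv = K⊆Y v Kv
      ... | inj₂ e rewrite ⁅⁆⇒≡ {z = z} {v} e = Yz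

module _ {n s : ℕ} (Inv : SimpleGraph n → Set) (X W Y₀ : VertexSet n)
  (Y₀⊆W : Y₀ ⊆ W) (W∩X : Disjoint W X) (s≤W : s ≤ card W) (sizeX : card X ≡ s)
  (indX : ∀ {G} → Inv G → Indep G X) (indY₀ : ∀ {G} → Inv G → Indep G Y₀)
  (pres : ∀ {G} z (z∉X : X z ≡ false) → Inv G → W z ≡ true → Y₀ z ≡ false → Inv (redirect G X z z∉X)) where

  private
    Partner : SimpleGraph n → VertexSet n → Set
    Partner G D = Indep G D × card D ≡ s × Disjoint D X

    partner? : ∀ G → Dec (∃ (Partner G))
    partner? G = search (Partner G)
      (λ D → indep? G D ×-dec ((card D ℕ.≟ s) ×-dec (all? λ v → true? (D v) →-dec ¬? (true? (X v)))))
      (λ eq (ind , size , dis) → Indep-cong {G = G} eq ind , trans (sym (card-cong eq)) size ,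
        λ v Tv → dis v (trans (eq v) Tv))

    Result : SimpleGraph n → Set
    Result G₀ = ∃[ G ] ∃[ D ] (Admissible G s × Inv G × degsum G₀ ≤ degsum G × Partner G D)

    grow : ∀ fuel G Y → Admissible G s → Inv G → Y₀ ⊆ Y → Y ⊆ W → Indep G Y → s ≤ card Y + fuel → Result G
    grow fuel G Y ok inv Y₀⊆Y Y⊆W indY room = decide fuel room (partner? G)
      where
      decide : ∀ fuel → s ≤ card Y + fuel → Dec (∃ (Partner G)) → Result G
      decide _ _ (yes (D , p)) = G , D , ok , inv , ≤-refl , p
      decide zero room (no none) = ⊥-elim (none (Y , indY ,
        ≤-antisym (indep≤ ok Y indY) (≤-trans room (≤-reflexive (+-identityʳ _))) , λ v Yv → W∩X v (Y⊆W v Yv)))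
      decide (suc fuel) room (no none) = step (larger-member W Y (<-≤-trans Y<s s≤W))
        where
        Y<s : card Y < s
        Y<s = ≤∧≢⇒< (indep≤ ok Y indY) (λ e → none (Y , indY , e , λ v Yv → W∩X v (Y⊆W v Yv)))
        step : ∃[ z ] (W z ≡ true × Y z ≡ false) → Result G
        step (z , Wz , Yz) = transfer (grow fuel G' (Y ∪ ⁅ z ⁆)
            (redirect-admissible z∉X ok (indX inv) (λ F ind size dis → ⊥-elim (none (F , ind , size , dis))))
            (pres z z∉X inv Wz (≢true (λ Y₀z → false≢true Yz (Y₀⊆Y z Y₀z))))
            (λ v h → ∨-left (Y₀⊆Y v h)) sub indY'
            (≤-trans room (≤-reflexive (trans (+-suc (card Y) fuel) (cong (_+ fuel) (sym (card-insert Y z Yz)))))))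
          where
          z∉X : X z ≡ false
          z∉X = ∉-disjoint {S = W} {X} W∩X Wz
          G' = redirect G X z z∉X
          sub : Y ∪ ⁅ z ⁆ ⊆ W
          sub v h with ∨-cases {Y v} h
          ... | inj₁ Yv = Y⊆W v Yv
          ... | inj₂ e rewrite ⁅⁆⇒≡ {z = z} {v} e = Wz
          onlyX : ∀ v w → (Y ∪ ⁅ z ⁆) w ≡ true → ⁅ z ⁆ v ≡ true → Adj G' v w → ⊥
          onlyX v w Hw e vw rewrite ⁅⁆⇒≡ {z = z} {v} e = W∩X w (sub w Hw) (trans (sym (redirected-from G X z w)) vw)
          indY' : Indep G' (Y ∪ ⁅ z ⁆)
          indY' i j Hi Hj ij with ∨-cases {Y i} Hi | ∨-cases {Y j} Hj
          ... | inj₂ e | _ = onlyX i j Hj e ij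
          ... | _ | inj₂ e = onlyX j i Hi e (Adj-sym G' {i} {j} ij)
          ... | inj₁ Yi | inj₁ Yj = redirect-indep {G = G} z∉X indY (inj₁ Yz) i j Yi Yj ij
          transfer : Result G' → Result G
          transfer (G″ , D , ok″ , inv″ , up , p) = G″ , D , ok″ , inv″ ,
            ≤-trans (redirect-degsum G X z z∉X (subst (deg G z ≤_) (sym sizeX) (deg≤ ok z))) up , p

  -- While no independent `s`-set avoids `X`, every vertex is forced vacuously, so vertices of `W`
  -- can be redirected to `X` one after another. A redirected vertex has no neighbour in `W`, so `Y`
  -- stays independent as it grows; on reaching size `s` it is the set sought. Vertices of `Y₀` are
  -- never redirected, which lets the caller protect them.
  connect : ∀ {G} → Admissible G s → Inv G →
    ∃[ G' ] ∃[ D ] (Admissible G' s × Inv G' × degsum G ≤ degsum G' × Indep G' D × card D ≡ s × Disjoint D X)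
  connect {G} ok inv = grow s G Y₀ ok inv (λ _ h → h) Y₀⊆W (indY₀ inv) (m≤n+m s (card Y₀))

max-indep : ∀ {n s} {G : SimpleGraph n} → Admissible G s → ∀ W →
  ∃[ E ] (Indep G E × E ⊆ W × (∀ F → Indep G F → F ⊆ W → card F ≤ card E))
max-indep {n} {s} {G} ok W = descend s (λ F ind _ → indep≤ ok F ind)
  where
  P : ℕ → VertexSet n → Set
  P k F = Indep G F × F ⊆ W × card F ≡ k
  descend : ∀ k → (∀ F → Indep G F → F ⊆ W → card F ≤ k) →
    ∃[ E ] (Indep G E × E ⊆ W × (∀ F → Indep G F → F ⊆ W → card F ≤ card E))
  descend k bound with search (P k)
    (λ F → indep? G F ×-dec ((all? λ v → true? (F v) →-dec true? (W v)) ×-dec (card F ℕ.≟ k)))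
    (λ eq (ind , sub , size) → Indep-cong {G = G} eq ind , (λ v Tv → sub v (trans (eq v) Tv)) , trans (sym (card-cong eq)) size)
  ... | yes (E , ind , sub , refl) = E , ind , sub , bound
  descend zero bound | no none = ⊥-elim (none (∅ , (λ _ _ ()) , (λ _ ()) , card-∅ n))
  descend (suc k) bound | no none = descend k (λ F ind sub → ≤-pred (≤∧≢⇒< (bound F ind sub) (λ e → none (F , ind , sub , e))))

-- Deleting an edge

delete : ∀ {n} → SimpleGraph (suc n) → Fin (suc n) → SimpleGraph n
delete G x = record
  { adj    = λ i j → adj G (punchIn x i) (punchIn x j)
  ; sym    = λ i j → SimpleGraph.sym G (punchIn x i) (punchIn x j)
  ; irrefl = λ i → irrefl G (punchIn x i)
  }

deg-delete : ∀ {n} (G : SimpleGraph (suc n)) x v → deg G (punchIn x v) ≡ bit (adj G (punchIn x v) x) + deg (delete G x) v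
deg-delete G x v = sum-remove {i = x} (bit ∘ adj G (punchIn x v))

degsum-delete : ∀ {n} (G : SimpleGraph (suc n)) x → degsum G ≡ deg G x + (deg G x + degsum (delete G x))
degsum-delete {n} G x = begin
  degsum G
    ≡⟨ sum-remove {i = x} (deg G) ⟩
  deg G x + ∑ (λ v → deg G (punchIn x v))
    ≡⟨ cong (deg G x +_) (sum-cong-≗ {n} (deg-delete G x)) ⟩
  deg G x + ∑ (λ v → bit (adj G (punchIn x v) x) + deg (delete G x) v)
    ≡⟨ cong (deg G x +_) (∑-distrib-+ (λ v → bit (adj G (punchIn x v) x)) _) ⟩
  deg G x + (∑ (λ v → bit (adj G (punchIn x v) x)) + degsum (delete G x))
    ≡⟨ cong (λ d → deg G x + (d + degsum (delete G x))) column ⟩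
  deg G x + (deg G x + degsum (delete G x)) ∎
  where
  open ≡-Reasoning
  column : ∑ (λ v → bit (adj G (punchIn x v) x)) ≡ deg G x
  column = sym (trans (sum-remove {i = x} (bit ∘ adj G x))
    (trans (cong (λ b → bit b + ∑ (λ v → bit (adj G x (punchIn x v)))) (irrefl G x))
      (sum-cong-≗ {n} (λ v → cong bit (SimpleGraph.sym G x (punchIn x v))))))

card-insertAt : ∀ {n} (S : VertexSet n) x → card (insertAt S x false) ≡ card S
card-insertAt {n} S x = trans (sum-remove {i = x} (bit ∘ insertAt S x false))
  (cong₂ (λ b r → bit b + r) (insertAt-lookup S x false) (sum-cong-≗ {n} (λ v → cong bit (insertAt-punchIn S x false v))))

insertAt-indep : ∀ {n} (G : SimpleGraph (suc n)) x S → Indep (delete G x) S → Indep G (insertAt S x false)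
insertAt-indep G x S ind i j Si Sj ij = ind (punchOut (off Si)) (punchOut (off Sj)) (down Si) (down Sj)
  (subst₂ (Adj G) (sym (punchIn-punchOut (off Si))) (sym (punchIn-punchOut (off Sj))) ij)
  where
  off : ∀ {v} → insertAt S x false v ≡ true → x ≢ v
  off Sv refl = false≢true (insertAt-lookup S x false) Sv
  down : ∀ {v} (Sv : insertAt S x false v ≡ true) → S (punchOut (off Sv)) ≡ true
  down Sv = trans (sym (insertAt-punchIn S x false _))
    (trans (cong (insertAt S x false) (punchIn-punchOut (off Sv))) Sv)

delete-triangleFree : ∀ {n} (G : SimpleGraph (suc n)) x → TriangleFree G → TriangleFree (delete G x)
delete-triangleFree G x tf i j k = tf (punchIn x i) (punchIn x j) (punchIn x k)

-- Independent sets of `H` are those of `G` avoiding `x` and `y`. Deleting both ends costs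
-- `2 * (deg G x + deg G y) - 2`, the edge between them being counted in both degrees; hence the `2`
-- on the left.
delete-edge : ∀ {n t} {G : SimpleGraph (suc (suc n))} → Admissible G (suc t) → ∀ {x y} → Adj G x y →
  (∃[ F ] (SizedIndep G (suc t) F × F x ≡ false × F y ≡ false)) ⊎
  (∃[ H ] (Admissible {n} H t × degsum G + 2 ≤ degsum H + 4 * suc t))
delete-edge {n} {t} {G} ok {x} {y} xy = decide (search P P? P-cong)
  where
  x≢y : x ≢ y
  x≢y refl = Adj-irrefl G xy
  y′ = punchOut x≢y
  y≡ : punchIn x y′ ≡ y
  y≡ = punchIn-punchOut x≢y
  G₁ = delete G x
  H = delete G₁ y′
  P : VertexSet n → Set
  P F = Indep H F × card F ≡ suc t
  P? : ∀ F → Dec (P F)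
  P? F = indep? H F ×-dec (card F ℕ.≟ suc t)
  P-cong : ∀ {S T} → (∀ v → S v ≡ T v) → P S → P T
  P-cong eq (ind , size) = Indep-cong {G = H} eq ind , trans (sym (card-cong eq)) size
  lift : VertexSet n → VertexSet (suc (suc n))
  lift F = insertAt (insertAt F y′ false) x false
  lift-indep : ∀ F → Indep H F → Indep G (lift F)
  lift-indep F ind = insertAt-indep G x _ (insertAt-indep G₁ y′ F ind)
  lift-card : ∀ F → card (lift F) ≡ card F
  lift-card F = trans (card-insertAt (insertAt F y′ false) x) (card-insertAt F y′)
  decide : Dec (∃ P) → _
  decide (yes (F , ind , size)) = inj₁ (lift F , (lift-indep F ind , trans (lift-card F) size) ,
    insertAt-lookup (insertAt F y′ false) x false ,
    trans (cong (lift F) (sym y≡)) (trans (insertAt-punchIn (insertAt F y′ false) x false y′) (insertAt-lookup F y′ false)))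
  decide (no none) = inj₂ (H , record
    { triangleFree = delete-triangleFree G₁ y′ (delete-triangleFree G x (triangleFree ok))
    ; indep≤ = λ F ind → ≤-pred (≤∧≢⇒< (subst (_≤ suc t) (lift-card F) (indep≤ ok (lift F) (lift-indep F ind)))
        (λ e → none (F , ind , e)))
    } , count)
    where
    degy : deg G y ≡ suc (deg G₁ y′)
    degy = trans (cong (deg G) (sym y≡)) (trans (deg-delete G x y′)
      (cong (λ b → bit b + deg G₁ y′) (trans (cong (λ v → adj G v x) y≡) (Adj-sym G xy))))
    count : degsum G + 2 ≤ degsum H + 4 * suc t
    count = subst (λ d → d + 2 ≤ degsum H + 4 * suc t) (sym (trans (degsum-delete G x) (cong (λ d → deg G x + (deg G x + d)) (degsum-delete G₁ y′))))
      (linear 0 (+-mono-≤ (+-mono-≤ dx dx) (+-mono-≤ dy dy))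
        (arith (deg G x) (deg G₁ y′) (degsum H) (suc t)))
      where
      dx = deg≤ ok x
      dy = subst (_≤ suc t) degy (deg≤ ok y)
      arith : ∀ x y h s → x + (x + (y + (y + h))) + 2 + (s + s + (s + s)) + 0 ≡ h + 4 * s + (x + x + (suc y + suc y))
      arith = solve-∀

-- Degrees around a pentagon of independent sets

packing : ∀ {n} (Ss : List (VertexSet n)) → AllPairs Disjoint Ss → cards Ss ≤ n
packing {n} Ss dis = subst₂ _≤_ (∑-bits Ss) (card-full n) (∑-mono (λ v → atMostOne v Ss dis))
  where
  none : ∀ v {S} Ss → All (Disjoint S) Ss → S v ≡ true → bits Ss v ≡ 0
  none v [] [] Sv = refl
  none v (T ∷ Ss) (d ∷ ds) Sv = cong₂ _+_ (cong bit (≢true (d v Sv))) (none v Ss ds Sv)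
  atMostOne : ∀ v Ss → AllPairs Disjoint Ss → bits Ss v ≤ 1
  atMostOne v [] [] = z≤n
  atMostOne v (S ∷ Ss) (d ∷ ds) with S v in eq
  ... | true  = s≤s (≤-reflexive (none v Ss d eq))
  ... | false = atMostOne v Ss ds

disjoint-⊆ : ∀ {n} {S S' T T' : VertexSet n} → S ⊆ S' → T ⊆ T' → Disjoint S' T' → Disjoint S T
disjoint-⊆ S⊆ T⊆ dis v Sv Tv = dis v (S⊆ v Sv) (T⊆ v Tv)

disjoint-sym : ∀ {n} {S T : VertexSet n} → Disjoint S T → Disjoint T S
disjoint-sym dis v Tv Sv = dis v Sv Tv

self : ∀ {n} {S : VertexSet n} → S ⊆ S
self v h = h

class-missed : ∀ {n} {G : SimpleGraph n} {K X v} → Class G K X → X v ≡ false → Disjoint (adj G v) K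
class-missed {G = G} {v = v} c Xv w vw Kw = false≢true Xv (trans (sym (nbhd c w v Kw)) (Adj-sym G vw))

indep-missed : ∀ {n} {G : SimpleGraph n} {X v} → Indep G X → X v ≡ true → Disjoint (adj G v) X
indep-missed {v = v} ind Xv w vw Xw = ind v w Xv Xw vw

-- With `e = s - k` the hypothesis amounts to `d ≤ n * s - a * b + k * k - 2 * a * k`. For
-- `a = k + c` the terms in `k` are minus the slack `k * k + 2 * (k * c)`.
pentagon-arith : ∀ k c b {a n s m e d} → a ≡ k + c → n ≡ 5 * a + 8 * b → s ≡ 2 * a + 3 * b → m ≡ a + b → e + k ≡ s →
  d + k * (s + (s + (e + (s + (s + (m + 0)))))) ≤ n * (3 * b + 2 * k) + a * (s + (s + (s + (s + (e + 0))))) →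
  d + a * b ≤ n * s
pentagon-arith k c b {e = e} {d} refl refl refl refl e+k h with +-cancelʳ-≡ k e (k + 2 * c + 3 * b) (trans e+k (size k c b))
  where
  size : ∀ k c b → 2 * (k + c) + 3 * b ≡ k + 2 * c + 3 * b + k
  size = solve-∀
... | refl = linear (k * k + 2 * (k * c)) h (identity k c b d)
  where
  identity : ∀ k c b d → let a = k + c; n = 5 * a + 8 * b; s = 2 * a + 3 * b; m = a + b; e = k + 2 * c + 3 * b in
    d + a * b + (n * (3 * b + 2 * k) + a * (s + (s + (s + (s + (e + 0)))))) + (k * k + 2 * (k * c)) ≡
    n * s + (d + k * (s + (s + (e + (s + (s + (m + 0)))))))
  identity = solve-∀

-- The five `single-` estimates pack the neighbourhood of a vertex together with sets that it
-- misses. They bound the degree by `3 * b + a + k` (vertices only in `A`, `D` or `E`), `3 * b + a`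
-- (only in `C`), `3 * b + a + 2 * k` (only in `B`) and `3 * b + 2 * k` (in none); the weights
-- multiplied by `k` record what this leaves of the right-hand side.
single-AD : ∀ k {a b n s m z d} → n ≡ 5 * a + 8 * b → s ≡ 2 * a + 3 * b → m ≡ a + b → z + k ≡ m →
  d + (s + (m + (z + 0))) ≤ n → d + k * 1 ≤ 3 * b + 2 * k + a * 1
single-AD k {a} {b} {z = z} {d} refl refl refl z≡ h = linear 0 (+-mono-≤ h (≤-reflexive (sym z≡))) (eq a b k z d)
  where
  eq : ∀ a b k z d → d + k * 1 + (5 * a + 8 * b + (z + k)) + 0 ≡
    3 * b + 2 * k + a * 1 + (d + (2 * a + 3 * b + (a + b + (z + 0))) + (a + b))
  eq = solve-∀

single-E : ∀ k {a b n s m e d} → n ≡ 5 * a + 8 * b → s ≡ 2 * a + 3 * b → m ≡ a + b → e + k ≡ s →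
  d + (e + (m + (m + 0))) ≤ n → d + k * 1 ≤ 3 * b + 2 * k + a * 1
single-E k {a} {b} {e = e} {d} refl refl refl e≡ h = linear 0 (+-mono-≤ h (≤-reflexive (sym e≡))) (eq a b k e d)
  where
  eq : ∀ a b k e d → d + k * 1 + (5 * a + 8 * b + (e + k)) + 0 ≡
    3 * b + 2 * k + a * 1 + (d + (e + (a + b + (a + b + 0))) + (2 * a + 3 * b))
  eq = solve-∀

single-C : ∀ k {a b n s m d} → n ≡ 5 * a + 8 * b → s ≡ 2 * a + 3 * b → m ≡ a + b →
  d + (s + (m + (m + 0))) ≤ n → d + k * 2 ≤ 3 * b + 2 * k + a * 1
single-C k {a} {b} {d = d} refl refl refl h = linear 0 h (eq a b k d)
  where
  eq : ∀ a b k d → d + k * 2 + (5 * a + 8 * b) + 0 ≡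
    3 * b + 2 * k + a * 1 + (d + (2 * a + 3 * b + (a + b + (a + b + 0))))
  eq = solve-∀

single-B : ∀ k {a b n s m y z d} → n ≡ 5 * a + 8 * b → s ≡ 2 * a + 3 * b → m ≡ a + b → y + k ≡ m → z + k ≡ m →
  d + (s + (y + (z + 0))) ≤ n → d + k * 0 ≤ 3 * b + 2 * k + a * 1
single-B k {a} {b} {y = y} {z} {d} refl refl refl y≡ z≡ h =
  linear 0 (+-mono-≤ h (+-mono-≤ (≤-reflexive (sym y≡)) (≤-reflexive (sym z≡)))) (eq a b k y z d)
  where
  eq : ∀ a b k y z d → d + k * 0 + (5 * a + 8 * b + (y + k + (z + k))) + 0 ≡
    3 * b + 2 * k + a * 1 + (d + (2 * a + 3 * b + (y + (z + 0))) + (a + b + (a + b)))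
  eq = solve-∀

single-none : ∀ k {a b n m y z d} → n ≡ 5 * a + 8 * b → m ≡ a + b → y + k ≡ m → z + k ≡ m →
  d + (m + (m + (m + (z + (y + 0))))) ≤ n → d + k * 0 ≤ 3 * b + 2 * k + a * 0
single-none k {a} {b} {y = y} {z} {d} refl refl y≡ z≡ h =
  linear 0 (+-mono-≤ h (+-mono-≤ (≤-reflexive (sym y≡)) (≤-reflexive (sym z≡)))) (eq a b k y z d)
  where
  eq : ∀ a b k y z d → d + k * 0 + (5 * a + 8 * b + (y + k + (z + k))) + 0 ≡
    3 * b + 2 * k + a * 0 + (d + (a + b + (a + b + (a + b + (z + (y + 0))))) + (a + b + (a + b)))
  eq = solve-∀

-- The pentagon A, B, D, C, E of independent sets, consecutive ones disjoint; E may lack k vertices.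
module Pentagon {n s m a b k : ℕ} (n≡ : n ≡ 5 * a + 8 * b) (s≡ : s ≡ 2 * a + 3 * b) (m≡ : m ≡ a + b) (k≤a : k ≤ a)
  {G : SimpleGraph n} (ok : Admissible G s) {A B D C E KA NB KD Z Y : VertexSet n}
  (indA : Indep G A) (indB : Indep G B) (indD : Indep G D) (indC : Indep G C) (indE : Indep G E)
  (sizeA : card A ≡ s) (sizeB : card B ≡ s) (sizeD : card D ≡ s) (sizeC : card C ≡ s) (sizeE : card E + k ≡ s)
  (A∩B : Disjoint A B) (B∩D : Disjoint B D) (D∩C : Disjoint D C) (C∩E : Disjoint C E) (E∩A : Disjoint E A)
  (clA : Class G KA A) (clB : Class G NB B) (clD : Class G KD D) (clC : Class G Z C) (clE : Class G Y E)
  (KA⊆B : KA ⊆ B) (KA⊆E : KA ⊆ E) (NB⊆A : NB ⊆ A) (NB⊆D : NB ⊆ D) (KD⊆B : KD ⊆ B) (KD⊆C : KD ⊆ C)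
  (Z⊆D : Z ⊆ D) (Z⊆E : Z ⊆ E) (Y⊆A : Y ⊆ A) (Y⊆C : Y ⊆ C)
  (sizeKA : card KA ≡ m) (sizeNB : card NB ≡ m) (sizeKD : card KD ≡ m) (sizeZ : card Z + k ≡ m) (sizeY : card Y + k ≡ m)
  (degAC : ∀ v → A v ≡ true → C v ≡ true → deg G v + k ≤ s) where

  private
    -- The multiplicity of a set is what its `single-` estimate leaves over, in units of `k`: `C`
    -- twice, `B` never. Vertices of `B ∩ E` thus have weight 1 where 2 is affordable, and `KA` uses
    -- this: without it the sum would leave a term `k * (b - a) + k * k`, which can be positive.
    low : List (VertexSet n)
    low = A ∷ D ∷ E ∷ C ∷ C ∷ KA ∷ []
    all : List (VertexSet n)
    all = A ∷ B ∷ D ∷ C ∷ E ∷ []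

    Bound : ℕ → ℕ → ℕ → Set
    Bound d x y = d + k * x ≤ 3 * b + 2 * k + a * y

    pair : ∀ {d} → d ≤ s → Bound d 2 2
    pair {d} h = linear 0 (≤-trans h (≤-reflexive s≡)) (eq a b k d)
      where
      eq : ∀ a b k d → d + k * 2 + (2 * a + 3 * b) + 0 ≡ 3 * b + 2 * k + a * 2 + d
      eq = solve-∀
    pair₁ : ∀ {d} → d ≤ s → Bound d 1 2
    pair₁ {d} h = linear k (≤-trans h (≤-reflexive s≡)) (eq a b k d)
      where
      eq : ∀ a b k d → d + k * 1 + (2 * a + 3 * b) + k ≡ 3 * b + 2 * k + a * 2 + d
      eq = solve-∀
    pair₃ : ∀ {d} → d + k ≤ s → Bound d 3 2
    pair₃ {d} h = linear 0 (≤-trans h (≤-reflexive s≡)) (eq a b k d)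
      where
      eq : ∀ a b k d → d + k * 3 + (2 * a + 3 * b) + 0 ≡ 3 * b + 2 * k + a * 2 + (d + k)
      eq = solve-∀

    Q : ℕ → Bool → Bool → Bool → Bool → Bool → Bool → Set
    Q d A B D C E K = Bound d (bit A + (bit D + (bit E + (bit C + (bit C + (bit K + 0))))))
      (bit A + (bit B + (bit D + (bit C + (bit E + 0)))))

    at : ∀ v → Q (deg G v) (A v) (B v) (D v) (C v) (E v) (KA v)
    at v = go (A v) (B v) (D v) (C v) (E v) (KA v) refl refl refl refl refl refl
      where
      N = adj G v
      bound₄ : ∀ S T U {s t u} → AllPairs Disjoint (N ∷ S ∷ T ∷ U ∷ []) → card S ≡ s → card T ≡ t → card U ≡ u →
        deg G v + (s + (t + (u + 0))) ≤ n
      bound₄ S T U dis refl refl refl = packing (N ∷ S ∷ T ∷ U ∷ []) dis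
      go : ∀ A' B' D' C' E' K' → A v ≡ A' → B v ≡ B' → D v ≡ D' → C v ≡ C' → E v ≡ E' → KA v ≡ K' → Q (deg G v) A' B' D' C' E' K'
      go true true _ _ _ _ eA eB _ _ _ _ = ⊥-elim (A∩B v eA eB)
      go _ true true _ _ _ _ eB eD _ _ _ = ⊥-elim (B∩D v eB eD)
      go _ _ true true _ _ _ _ eD eC _ _ = ⊥-elim (D∩C v eD eC)
      go _ _ _ true true _ _ _ _ eC eE _ = ⊥-elim (C∩E v eC eE)
      go true _ _ _ true _ eA _ _ _ eE _ = ⊥-elim (E∩A v eE eA)
      go _ false _ _ _ true _ eB _ _ _ eK = ⊥-elim (false≢true eB (KA⊆B v eK))
      go _ _ _ _ false true _ _ _ _ eE eK = ⊥-elim (false≢true eE (KA⊆E v eK))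
      go true false true false false false _ _ _ _ _ _ = pair (deg≤ ok v)
      -- Weight 3 is one more than `deg G v ≤ s` affords; hence the sharper hypothesis on `A ∩ C`.
      go true false false true false false eA _ _ eC _ _ = pair₃ (degAC v eA eC)
      go false false true false true false _ _ _ _ _ _ = pair (deg≤ ok v)
      go false true false true false false _ _ _ _ _ _ = pair (deg≤ ok v)
      go false true false false true false _ _ _ _ _ _ = pair₁ (deg≤ ok v)
      go false true false false true true _ _ _ _ _ _ = pair (deg≤ ok v)
      go true false false false false false eA eB eD eC eE _ = single-AD k {a} {b} n≡ s≡ m≡ sizeZ
        (bound₄ A KD Z
          ((indep-missed {G = G} indA eA ∷ class-missed clD eD ∷ class-missed clC eC ∷ []) ∷
           (disjoint-⊆ self KD⊆B A∩B ∷ disjoint-sym (disjoint-⊆ Z⊆E self E∩A) ∷ []) ∷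
           (disjoint-⊆ KD⊆B Z⊆D B∩D ∷ []) ∷ [] ∷ []) sizeA sizeKD refl)
      go false false true false false false eA eB eD eC eE _ = single-AD k {a} {b} n≡ s≡ m≡ sizeY
        (bound₄ D KA Y
          ((indep-missed {G = G} indD eD ∷ class-missed clA eA ∷ class-missed clE eE ∷ []) ∷
           (disjoint-sym (disjoint-⊆ KA⊆B self B∩D) ∷ disjoint-⊆ self Y⊆C D∩C ∷ []) ∷
           (disjoint-sym (disjoint-⊆ Y⊆A KA⊆B A∩B) ∷ []) ∷ [] ∷ []) sizeD sizeKA refl)
      go false false false false true false eA eB eD eC eE _ = single-E k {a} {b} n≡ s≡ m≡ sizeE
        (bound₄ E NB KD
          ((indep-missed {G = G} indE eE ∷ class-missed clB eB ∷ class-missed clD eD ∷ []) ∷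
           (disjoint-⊆ self NB⊆A E∩A ∷ disjoint-sym (disjoint-⊆ KD⊆C self C∩E) ∷ []) ∷
           (disjoint-⊆ NB⊆A KD⊆B A∩B ∷ []) ∷ [] ∷ []) refl sizeNB sizeKD)
      go false false false true false false eA eB eD eC eE _ = single-C k {a} {b} n≡ s≡ m≡
        (bound₄ C KA NB
          ((indep-missed {G = G} indC eC ∷ class-missed clA eA ∷ class-missed clB eB ∷ []) ∷
           (disjoint-⊆ self KA⊆E C∩E ∷ disjoint-sym (disjoint-⊆ NB⊆D self D∩C) ∷ []) ∷
           (disjoint-sym (disjoint-⊆ NB⊆A KA⊆B A∩B) ∷ []) ∷ [] ∷ []) sizeC sizeKA sizeNB)
      go false true false false false false eA eB eD eC eE _ = single-B k {a} {b} n≡ s≡ m≡ sizeY sizeZ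
        (bound₄ B Y Z
          ((indep-missed {G = G} indB eB ∷ class-missed clE eE ∷ class-missed clC eC ∷ []) ∷
           (disjoint-sym (disjoint-⊆ Y⊆A self A∩B) ∷ disjoint-⊆ self Z⊆D B∩D ∷ []) ∷
           (disjoint-sym (disjoint-⊆ Z⊆D Y⊆C D∩C) ∷ []) ∷ [] ∷ []) sizeB refl refl)
      go false false false false false false eA eB eD eC eE _ = single-none k {a} {b} n≡ m≡ sizeY sizeZ
        (subst (λ x → deg G v + x ≤ n)
          (cong₂ _+_ sizeKA (cong₂ _+_ sizeNB (cong (_+ (card Z + (card Y + 0))) sizeKD)))
          (packing (N ∷ KA ∷ NB ∷ KD ∷ Z ∷ Y ∷ [])
          ((class-missed clA eA ∷ class-missed clB eB ∷ class-missed clD eD ∷ class-missed clC eC ∷ class-missed clE eE ∷ []) ∷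
           (disjoint-sym (disjoint-⊆ NB⊆A KA⊆B A∩B) ∷ disjoint-sym (disjoint-⊆ KD⊆C KA⊆E C∩E) ∷ disjoint-⊆ KA⊆B Z⊆D B∩D ∷ disjoint-sym (disjoint-⊆ Y⊆A KA⊆B A∩B) ∷ []) ∷
           (disjoint-⊆ NB⊆A KD⊆B A∩B ∷ disjoint-sym (disjoint-⊆ Z⊆E NB⊆A E∩A) ∷ disjoint-⊆ NB⊆D Y⊆C D∩C ∷ []) ∷
           (disjoint-⊆ KD⊆B Z⊆D B∩D ∷ disjoint-sym (disjoint-⊆ Y⊆A KD⊆B A∩B) ∷ []) ∷
           (disjoint-⊆ Z⊆D Y⊆C D∩C ∷ []) ∷ [] ∷ [])))

  pentagon-bound : degsum G + a * b ≤ n * s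
  pentagon-bound = pentagon-arith k (a ∸ k) b (sym (m+[n∸m]≡n k≤a)) n≡ s≡ m≡ sizeE
    (subst₂ _≤_ left right (∑-mono at))
    where
    scaled : ∀ c Ss → ∑ (λ v → c * bits Ss v) ≡ c * cards Ss
    scaled c Ss = trans (∑-scale c (bits Ss)) (cong (c *_) (∑-bits Ss))
    left : ∑ (λ v → deg G v + k * bits low v) ≡ degsum G + k * (s + (s + (card E + (s + (s + (m + 0))))))
    left = trans (∑-distrib-+ (deg G) _) (cong (degsum G +_) (trans (scaled k low)
      (cong (k *_) (cong₂ _+_ sizeA (cong₂ _+_ sizeD (cong (card E +_) (cong₂ _+_ sizeC (cong₂ _+_ sizeC (cong (_+ 0) sizeKA)))))))))
    right : ∑ (λ v → 3 * b + 2 * k + a * bits all v) ≡ n * (3 * b + 2 * k) + a * (s + (s + (s + (s + (card E + 0)))))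
    right = trans (∑-distrib-+ {n} (λ _ → 3 * b + 2 * k) (λ v → a * bits all v)) (cong₂ _+_ (∑-const n (3 * b + 2 * k)) (trans (scaled a all)
      (cong (a *_) (cong₂ _+_ sizeA (cong₂ _+_ sizeB (cong₂ _+_ sizeD (cong (_+ (card E + 0)) sizeC)))))))

Maximal : ∀ {n} → SimpleGraph n → VertexSet n → VertexSet n → VertexSet n → Set
Maximal G A C E = ∀ F → Indep G F → Disjoint F A → Disjoint F C → card F ≤ card E

-- The analogue of `class-absorbed` when `E` is only largest among the independent sets avoiding `A`
-- and `C`; hence `K` has to avoid them too.
maximal-absorbs : ∀ {n} {G : SimpleGraph n} {A C E K X} → Maximal G A C E → Indep G E →
  Disjoint E A → Disjoint E C → Class G K X → Disjoint E X → Disjoint K A → Disjoint K C → K ⊆ E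
maximal-absorbs {E = E} {K} max indE EA EC cl EX KA KC v Kv with true? (E v)
... | yes Ev = Ev
... | no Ev = ⊥-elim (<-irrefl refl (≤-trans (≤-reflexive (sym (card-insert E v (≢true Ev))))
  (≤-trans (card-⊆ {S = E ∪ ⁅ v ⁆} {E ∪ K} sub)
    (max (E ∪ K) (class-∪-indep cl indE EX) (both EA KA) (both EC KC)))))
  where
  sub : E ∪ ⁅ v ⁆ ⊆ E ∪ K
  sub w h with ∨-cases {E w} h
  ... | inj₁ Ew = ∨-left Ew
  ... | inj₂ e rewrite ⁅⁆⇒≡ {z = v} {w} e = ∨-right {E v} Kv
  both : ∀ {T} → Disjoint E T → Disjoint K T → Disjoint (E ∪ K) T
  both ET KT w h Tw with ∨-cases {E w} h
  ... | inj₁ Ew = ET w Ew Tw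
  ... | inj₂ Kw = KT w Kw Tw

-- Completing a path of independent sets to a pentagon

record Path {n} (s m : ℕ) (A B D C KA NB KD : VertexSet n) : Set where
  field
    sizeA : card A ≡ s
    sizeB : card B ≡ s
    sizeD : card D ≡ s
    sizeC : card C ≡ s
    A∩B : Disjoint A B
    B∩D : Disjoint B D
    D∩C : Disjoint D C
    C∩KA : Disjoint C KA
    KA⊆B : KA ⊆ B
    NB⊆A : NB ⊆ A
    NB⊆D : NB ⊆ D
    KD⊆B : KD ⊆ B
    KD⊆C : KD ⊆ C
    sizeKA : card KA ≡ m
    sizeNB : card NB ≡ m
    sizeKD : card KD ≡ m

-- The conditions that depend on the graph, kept apart from `Path` because the sets stay fixed while
-- the graph is redirected.
record Frame {n} (A B D C KA NB KD : VertexSet n) (G : SimpleGraph n) : Set where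
  field
    indA : Indep G A
    indB : Indep G B
    indD : Indep G D
    indC : Indep G C
    clA : Class G KA A
    clB : Class G NB B
    clD : Class G KD D

module _ {n s m a b : ℕ} (n≡ : n ≡ 5 * a + 8 * b) (s≡ : s ≡ 2 * a + 3 * b) (m≡ : m ≡ a + b)
  {A B D C KA NB KD : VertexSet n} (path : Path s m A B D C KA NB KD) where
  open Path path

  private
    F : SimpleGraph n → Set
    F = Frame A B D C KA NB KD

    Goal : SimpleGraph n → Set
    Goal G = degsum G + a * b ≤ n * s

    3m≡ : 3 * m ≡ s + a
    3m≡ = trans (cong (3 *_) m≡) (trans (eq a b) (cong (_+ a) (sym s≡)))
      where
      eq : ∀ a b → 3 * (a + b) ≡ 2 * a + 3 * b + a
      eq = solve-∀

    m+n≡ : m + n ≡ 3 * s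
    m+n≡ = trans (cong₂ _+_ m≡ n≡) (trans (eq a b) (cong (3 *_) (sym s≡)))
      where
      eq : ∀ a b → a + b + (5 * a + 8 * b) ≡ 3 * (2 * a + 3 * b)
      eq = solve-∀

  frame-redirect : ∀ {G X z} (z∉X : X z ≡ false) → F G →
    A z ≡ false ⊎ Disjoint A X → B z ≡ false ⊎ Disjoint B X → D z ≡ false ⊎ Disjoint D X → C z ≡ false ⊎ Disjoint C X →
    KA z ≡ false → NB z ≡ false → KD z ≡ false →
    (∀ v → KA v ≡ true → X v ≡ A z) → (∀ v → NB v ≡ true → X v ≡ B z) → (∀ v → KD v ≡ true → X v ≡ D z) →
    F (redirect G X z z∉X)
  frame-redirect {G} z∉X f dA dB dD dC zA zB zD eA eB eD = record
    { indA = redirect-indep {G = G} z∉X (Frame.indA f) dA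
    ; indB = redirect-indep {G = G} z∉X (Frame.indB f) dB
    ; indD = redirect-indep {G = G} z∉X (Frame.indD f) dD
    ; indC = redirect-indep {G = G} z∉X (Frame.indC f) dC
    ; clA = class-redirect z∉X (Frame.clA f) zA eA
    ; clB = class-redirect z∉X (Frame.clB f) zB eB
    ; clD = class-redirect z∉X (Frame.clD f) zD eD
    }

  -- `NB` can be exchanged for `S ∩ B`, and `KA` together with `KD` for `S ∩ (A ∪ D)`, so `S ∖ B`
  -- has at most `s - m` and `S ∖ (A ∪ D)` at most `s - 2 * m` vertices. As `B` misses `A ∪ D`,
  -- these two cover `S`, and `3 * m = s + a`.
  domination : ∀ {G S} → Admissible G s → F G → Indep G S →
    Disjoint S KA → Disjoint S NB → Disjoint S KD → card S + a ≤ s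
  domination {G} {S} ok f ind SKA SNB SKD = linear 0
    (+-mono-≤ (+-mono-≤ exchange₁ exchange₂) (+-mono-≤ cover (≤-reflexive (sym 3m≡))))
    (arith (card S) s a m (card (S ∖ B)) (card (S ∖ (A ∪ D))))
    where
    open Frame f
    arith : ∀ c s a m x y → c + a + (s + s + (x + y + 3 * m)) + 0 ≡ s + (x + m + (y + m + m) + (c + (s + a)))
    arith = solve-∀
    exchange₁ : card (S ∖ B) + m ≤ s
    exchange₁ = subst (λ k → card (S ∖ B) + k ≤ s) sizeNB (class-exchange ok clB ind SNB)
    rest = S ∖ (A ∪ D)
    rest-A : Disjoint rest A
    rest-A v h Av = not-true (∧-right {S v} h) (∨-left Av)
    rest-D : Disjoint (rest ∪ KA) D
    rest-D v h Dv with ∨-cases {rest v} h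
    ... | inj₁ r = not-true (∧-right {S v} r) (∨-right {A v} Dv)
    ... | inj₂ k = B∩D v (KA⊆B v k) Dv
    disjoint₁ : Disjoint rest KA
    disjoint₁ v h = SKA v (∧-left h)
    disjoint₂ : Disjoint (rest ∪ KA) KD
    disjoint₂ v h k with ∨-cases {rest v} h
    ... | inj₁ r = SKD v (∧-left r) k
    ... | inj₂ r = C∩KA v (KD⊆C v k) r
    exchange₂ : card rest + m + m ≤ s
    exchange₂ = ≤-trans (subst₂ (λ x y → card rest + x + y ≤ card ((rest ∪ KA) ∪ KD)) sizeKA sizeKD
        (≤-trans (+-monoˡ-≤ (card KD) (card-∪-disjoint rest KA disjoint₁)) (card-∪-disjoint (rest ∪ KA) KD disjoint₂)))
      (indep≤ ok _ (class-∪-indep clD (class-∪-indep clA (λ i j Si Sj → ind i j (∧-left Si) (∧-left Sj)) rest-A) rest-D))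
    cover : card S ≤ card (S ∖ B) + card rest
    cover = subst₂ _≤_ (+-identityʳ _) (cong (card (S ∖ B) +_) (+-identityʳ _))
      (cards-mono (S ∷ []) (S ∖ B ∷ rest ∷ []) (λ v → at (S v) (A v) (B v) (D v) (A∩B v) (B∩D v)))
      where
      at : ∀ s a b d → (a ≡ true → b ≡ true → ⊥) → (b ≡ true → d ≡ true → ⊥) →
        bit s + 0 ≤ bit (s ∧ not b) + (bit (s ∧ not (a ∨ d)) + 0)
      at false _ _ _ _ _ = z≤n
      at true _ false _ _ _ = s≤s z≤n
      at true true true _ h _ = ⊥-elim (h refl refl)
      at true false true true _ h = ⊥-elim (h refl refl)
      at true false true false _ _ = s≤s z≤n

  private
    KA-absorbed : ∀ {G E} → F G → Maximal G A C E → Indep G E → Disjoint E A → Disjoint E C → KA ⊆ E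
    KA-absorbed f max indE EA EC = maximal-absorbs max indE EA EC (Frame.clA f) EA (class-disjoint (Frame.clA f)) (disjoint-sym C∩KA)

  -- If the neighbourhood of `v` meets `KA`, it avoids `A`; it avoids `C` because `v` lies in `C`;
  -- so it competes with `E`. Otherwise it avoids `KA`, `NB` (as `v` is outside `B`) and `KD` (a
  -- part of `C`), and `domination` applies.
  degree-C∖B : ∀ {G E} → Admissible G s → F G → Maximal G A C E → ∀ v → C v ≡ true → B v ≡ false →
    deg G v ≤ card E ⊎ deg G v + a ≤ s
  degree-C∖B {G} {E} ok f max v Cv Bv with any? (λ u → true? ((adj G v ∩ KA) u))
  ... | yes (u , h) = inj₁ (max (adj G v) (nbhd-indep ok v)
    (meets⇒disjoint (Frame.clA f) (nbhd-indep ok v) (∧-right {adj G v u} h) (∧-left h))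
    (indep-missed {G = G} (Frame.indC f) Cv))
  ... | no none = inj₂ (domination ok f (nbhd-indep ok v)
    (λ u vu Ku → none (u , ∧-both vu Ku))
    (class-missed (Frame.clB f) Bv)
    (disjoint-⊆ self KD⊆C (indep-missed {G = G} (Frame.indC f) Cv)))

  -- `C` misses `KA`, so `KA` can be exchanged for `C ∩ A` and is no larger.
  A∩C-large : ∀ {G} → Admissible G s → F G → m ≤ card (C ∩ A)
  A∩C-large {G} ok f = linear 0 (+-mono-≤ (class-exchange ok (Frame.clA f) (Frame.indC f) C∩KA) (card-∖-∩ C A))
    (trans (arith m s (card (C ∖ A)) (card (C ∩ A))) (cong₂ (λ k c → card (C ∩ A) + (card (C ∖ A) + k + c)) (sym sizeKA) (sym sizeC)))
    where
    arith : ∀ m s x y → m + (s + (x + y)) + 0 ≡ y + (x + m + s)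
    arith = solve-∀

  deficit : ∀ {G} → Admissible G s → F G → (∀ v → C v ≡ true → A v ≡ true → deg G v + a ≤ s) → Goal G
  deficit {G} ok f small = ≤-trans (+-monoʳ-≤ (degsum G) (*-monoʳ-≤ a b≤))
    (subst₂ _≤_ (trans (∑-distrib-+ (deg G) _) (cong (degsum G +_) (∑-scale a (bit ∘ (C ∩ A))))) (∑-const n s) (∑-mono at))
    where
    b≤ : b ≤ card (C ∩ A)
    b≤ = ≤-trans (m≤n+m b a) (≤-trans (≤-reflexive (sym m≡)) (A∩C-large ok f))
    at : ∀ v → deg G v + a * bit ((C ∩ A) v) ≤ s
    at v with C v in eC | A v in eA
    ... | true | true = subst (λ x → deg G v + x ≤ s) (sym (*-identityʳ a)) (small v eC eA)
    ... | true | false = subst (_≤ s) (sym (trans (cong (deg G v +_) (*-zeroʳ a)) (+-identityʳ _))) (deg≤ ok v)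
    ... | false | _ = subst (_≤ s) (sym (trans (cong (deg G v +_) (*-zeroʳ a)) (+-identityʳ _))) (deg≤ ok v)

  -- The redirections towards `E` keep the degree sum because a vertex of `A ∩ C` has degree at most
  -- `card E`: the second alternative of `degree-C∖B` gives `s - a`, which is at most `s - k`.
  -- `Maximal` belongs to the invariant for this reason; it survives because sets avoiding `A` do
  -- not contain the redirected vertex. The room is `3 * s - k - n = m - k`, the size of `Z`.
  close : ∀ {G E Z k} → Admissible G s → F G → Maximal G A C E → Indep G E → Disjoint E A → Disjoint E C →
    card E + k ≡ s → k ≤ a → Class G Z C → Z ⊆ D → Disjoint Z A → card Z + k ≡ m → Goal G
  close {G} {E} {Z} {k} ok f max indE EA EC sizeE k≤a clZ Z⊆D ZA sizeZ = finish
    (fill Inv E A C (λ (f , _ , ind , _) → ind , Frame.indA f , Frame.indC f) (disjoint-sym EA) (disjoint-sym EC) degE pres (card Z) room ok (f , clZ , indE , max))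
    where
    Inv : SimpleGraph n → Set
    Inv G = F G × Class G Z C × Indep G E × Maximal G A C E
    Z⊆E : Z ⊆ E
    Z⊆E = maximal-absorbs max indE EA EC clZ EC ZA (class-disjoint clZ)
    KA⊆E : KA ⊆ E
    KA⊆E = KA-absorbed f max indE EA EC
    room : card Z + n ≤ card A + card C + card E
    room = linear 0 (+-mono-≤ (≤-reflexive m+n≡) (+-mono-≤ (≤-reflexive sizeZ) (≤-reflexive (sym sizeE))))
      (trans (arith (card Z) n s (card E) k m) (cong₂ (λ x y → x + y + card E + (m + n + (card Z + k + s))) (sym sizeA) (sym sizeC)))
      where
      arith : ∀ z n s e k m → z + n + (3 * s + (m + (e + k))) + 0 ≡ s + s + e + (m + n + (z + k + s))
      arith = solve-∀
    degE : ∀ {G} → Admissible G s → Inv G → ∀ z → A z ≡ true → C z ≡ true → deg G z ≤ card E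
    degE {G} ok (f , _ , _ , max) z Az Cz with degree-C∖B ok f max z Cz (∉-disjoint {S = A} {B} A∩B Az)
    ... | inj₁ h = h
    ... | inj₂ h = linear 0 (+-mono-≤ h (+-mono-≤ (≤-reflexive (sym sizeE)) k≤a)) (arith (deg G z) s (card E) k a)
      where
      arith : ∀ d s e k a → d + (s + (e + k + a)) + 0 ≡ e + (d + a + (s + k))
      arith = solve-∀
    pres : ∀ {G} z (z∉E : E z ≡ false) → Inv G → A z ≡ true → C z ≡ true → Inv (redirect G E z z∉E)
    pres {G} z z∉E (f , clZ , indE , max) Az Cz =
      frame-redirect z∉E f (inj₂ (disjoint-sym EA)) (inj₁ Bz) (inj₁ Dz) (inj₂ (disjoint-sym EC))
        (≢true (λ h → class-disjoint (Frame.clA f) z h Az)) (≢true (λ h → D∩C z (NB⊆D z h) Cz)) (≢true (λ h → false≢true Bz (KD⊆B z h)))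
        (λ v h → trans (KA⊆E v h) (sym Az)) (λ v h → trans (≢true (λ Ev → EA v Ev (NB⊆A v h))) (sym Bz))
        (λ v h → trans (≢true (λ Ev → EC v Ev (KD⊆C v h))) (sym Dz)) ,
      class-redirect z∉E clZ (≢true (λ h → ZA z h Az)) (λ v h → trans (Z⊆E v h) (sym Cz)) ,
      redirect-indep {G = G} z∉E indE (inj₁ z∉E) ,
      λ S ind SA SC → max S (redirect-old z∉E (≢true (λ Sz → SA z Sz Az)) ind) SA SC
      where
      Bz : B z ≡ false
      Bz = ∉-disjoint {S = A} {B} A∩B Az
      Dz : D z ≡ false
      Dz = ≢true (λ Dz → D∩C z Dz Cz)
    finish : _ → Goal G
    finish (G' , Y , ok' , (f' , clZ' , indE' , max') , up , clY , Y⊆A , Y⊆C , sizeY) = ≤-trans (+-monoˡ-≤ (a * b) up)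
      (Pentagon.pentagon-bound n≡ s≡ m≡ k≤a ok' indA indB indD indC indE' sizeA sizeB sizeD sizeC sizeE
        A∩B B∩D D∩C (disjoint-sym EC) EA clA clB clD clZ' clY KA⊆B KA⊆E NB⊆A NB⊆D KD⊆B KD⊆C Z⊆D Z⊆E Y⊆A Y⊆C
        sizeKA sizeNB sizeKD sizeZ (trans (cong (_+ k) sizeY) sizeZ)
        (λ v Av Cv → ≤-trans (+-monoˡ-≤ k (degE ok' (f' , clZ' , indE' , max') v Av Cv)) (≤-reflexive sizeE)))
      where open Frame f'

  private
    -- The target `m - k` for the size of `Z` depends on `E`, and a redirection may create a larger
    -- independent set outside `A ∪ C`. So `E` is chosen anew in every round, while `fuel` only has
    -- to cover `m - card Z`.
    partial : ∀ fuel {G Z} → m ≤ fuel + card Z → Admissible G s → F G → Class G Z C → Z ⊆ D → Disjoint Z A → Goal G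
    partial fuel {G} {Z} enough ok f clZ Z⊆D ZA with max-indep ok (full ∖ (A ∪ C))
    ... | E , indE , E⊆ , max₀ = compare fuel enough (m + card E ≤? card Z + s)
      where
      EA : Disjoint E A
      EA v Ev Av = not-true (∧-right {true} (E⊆ v Ev)) (∨-left Av)
      EC : Disjoint E C
      EC v Ev Cv = not-true (∧-right {true} (E⊆ v Ev)) (∨-right {A v} Cv)
      max : Maximal G A C E
      max S ind SA SC = max₀ S ind (λ v Sv → cong not (cong₂ _∨_ (≢true (SA v Sv)) (≢true (SC v Sv))))
      E≤s : card E ≤ s
      E≤s = indep≤ ok E indE
      k = s ∸ card E
      sizeE : card E + k ≡ s
      sizeE = m+[n∸m]≡n E≤s
      compare : ∀ fuel → m ≤ fuel + card Z → Dec (m + card E ≤ card Z + s) → Goal G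
      compare fuel enough (yes big) with k ≤? a
      ... | no k≰a = deficit ok f small
        where
        small : ∀ v → C v ≡ true → A v ≡ true → deg G v + a ≤ s
        small v Cv Av with degree-C∖B ok f max v Cv (∉-disjoint {S = A} {B} A∩B Av)
        ... | inj₂ h = h
        ... | inj₁ h = ≤-trans (+-mono-≤ h (<⇒≤ (≰⇒> k≰a))) (≤-reflexive sizeE)
      -- The comparison gives only a lower bound for `card Z`, while `close` wants an exact size;
      -- part of a class is again a class.
      ... | yes k≤a = shrink (subset-of-size (m ∸ k) Z Z-large)
        where
        k≤m : k ≤ m
        k≤m = ≤-trans k≤a (≤-trans (m≤m+n a b) (≤-reflexive (sym m≡)))
        Z-large : m ∸ k ≤ card Z
        Z-large = linear 0 (+-mono-≤ big (+-mono-≤ (≤-reflexive (sym sizeE)) (≤-reflexive (m∸n+n≡m k≤m))))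
          (arith (m ∸ k) (card Z) s (card E) k m)
          where
          arith : ∀ x z s e k m → x + (z + s + (e + k + m)) + 0 ≡ z + (m + e + (s + (x + k)))
          arith = solve-∀
        shrink : ∃[ Z' ] (Z' ⊆ Z × card Z' ≡ m ∸ k) → Goal G
        shrink (Z' , Z'⊆Z , size) = close ok f max indE EA EC sizeE k≤a (class-⊆ Z'⊆Z clZ)
          (λ v h → Z⊆D v (Z'⊆Z v h)) (λ v h → ZA v (Z'⊆Z v h)) (trans (cong (_+ k) size) (m∸n+n≡m k≤m))
      compare zero enough (no small) = ⊥-elim (small (+-mono-≤ enough E≤s))
      -- Taking `E` as the second set keeps the new vertex outside `A`, so that `A` stays
      -- independent and `Z` disjoint from `A`.
      compare (suc fuel) enough (no small) = step (forced-vertex ok C D E Z (Frame.indD f) indE D∩C EC room)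
        where
        room : card Z + n < card D + card E + card C
        room = linear 0 (+-mono-≤ (≰⇒> small) (≤-reflexive m+n≡))
          (trans (arith (card Z) n s (card E) m) (cong₂ (λ x y → x + card E + y + (suc (card Z + s) + (m + n))) (sym sizeD) (sym sizeC)))
          where
          arith : ∀ z n s e m → suc (z + n) + (m + e + 3 * s) + 0 ≡ s + e + s + (suc (z + s) + (m + n))
          arith = solve-∀
        step : _ → Goal G
        step (z , Dz , Ez , Zz , forced) = ≤-trans (+-monoˡ-≤ (a * b) (redirect-degsum G C z z∉C (subst (deg G z ≤_) (sym sizeC) (deg≤ ok z))))
          (partial fuel
            (≤-trans enough (≤-reflexive (trans (sym (+-suc fuel (card Z))) (cong (fuel +_) (sym (card-insert Z z Zz))))))
            (redirect-admissible z∉C ok (Frame.indC f) forced) f' (class-insert z∉C clZ) sub dis)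
          where
          z∉C : C z ≡ false
          z∉C = ∉-disjoint {S = D} {C} D∩C Dz
          Az : A z ≡ false
          Az = ∉-disjoint {S = E} {A} EA Ez
          Bz : B z ≡ false
          Bz = ≢true (λ Bz → B∩D z Bz Dz)
          f' : F (redirect G C z z∉C)
          f' = frame-redirect z∉C f (inj₁ Az) (inj₁ Bz) (inj₂ D∩C) (inj₁ z∉C)
            (≢true (λ h → false≢true Bz (KA⊆B z h))) (≢true (λ h → false≢true Az (NB⊆A z h))) (≢true (λ h → false≢true Bz (KD⊆B z h)))
            (λ v h → trans (≢true (λ Cv → C∩KA v Cv h)) (sym Az))
            (λ v h → trans (∉-disjoint {S = D} {C} D∩C (NB⊆D v h)) (sym Bz))
            (λ v h → trans (KD⊆C v h) (sym Dz))
          sub : Z ∪ ⁅ z ⁆ ⊆ D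
          sub v h with ∨-cases {Z v} h
          ... | inj₁ Zv = Z⊆D v Zv
          ... | inj₂ e rewrite ⁅⁆⇒≡ {z = z} {v} e = Dz
          dis : Disjoint (Z ∪ ⁅ z ⁆) A
          dis v h Av with ∨-cases {Z v} h
          ... | inj₁ Zv = ZA v Zv Av
          ... | inj₂ e rewrite ⁅⁆⇒≡ {z = z} {v} e = false≢true Az Av

  path-bound : ∀ {G} → Admissible G s → F G → Goal G
  path-bound {G} ok f = partial m {Z = ∅} (m≤m+n m _) ok f (class λ _ _ ()) (λ _ ()) (λ _ ())

-- From one independent set of size `s` to a path

overfull : ∀ {a b n s m} → n ≡ 5 * a + 8 * b → s ≡ 2 * a + 3 * b → m ≡ a + b → 1 ≤ a → s + (s + (m + (m + 0))) ≤ n → ⊥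
overfull {suc a} {b} refl refl refl (s≤s _) h = contradictory a h (eq a b)
  where
  eq : ∀ a b → 2 * suc a + 3 * b + (2 * suc a + 3 * b + (suc a + b + (suc a + b + 0))) ≡ suc (5 * suc a + 8 * b + a)
  eq = solve-∀

-- In the parameters, `n * s - a * b` is `10a² + 30ab + 24b²`. Removing two vertices and one unit of
-- `s` turns `(a , b)` into `(a - 2 , b + 1)`, where this form is smaller by `10 * a + 12 * b - 4`:
-- that is the second hypothesis. Adding back `4 * s - 2` leaves the surplus `2 - 2 * a`, whence
-- `1 ≤ a`.
edge-arith : ∀ {a b n s dG dH} → n ≡ 5 * a + 8 * b → s ≡ 2 * a + 3 * b → 1 ≤ a → dG + 2 ≤ dH + 4 * s →
  dH + (10 * a + 12 * b) ≤ 10 * (a * a) + 30 * (a * b) + 24 * (b * b) + 4 → dG + a * b ≤ n * s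
edge-arith {suc a} {b} {dG = dG} {dH} refl refl (s≤s _) h₁ h₂ = linear (2 * a) (+-mono-≤ h₁ h₂) (eq a b dG dH)
  where
  eq : ∀ a b g h → g + suc a * b + (h + 4 * (2 * suc a + 3 * b) + (10 * (suc a * suc a) + 30 * (suc a * b) + 24 * (b * b) + 4)) + 2 * a ≡
    (5 * suc a + 8 * b) * (2 * suc a + 3 * b) + (g + 2 + (h + (10 * suc a + 12 * b)))
  eq = solve-∀

-- The two function hypotheses are where the induction enters: each supplies an independent `s`-set
-- or, failing that, the goal from a smaller instance.
module _ {n s m a b : ℕ} (n≡ : n ≡ 5 * a + 8 * b) (s≡ : s ≡ 2 * a + 3 * b) (m≡ : m ≡ a + b) (1≤a : 1 ≤ a)
  (largeSet : ∀ {G : SimpleGraph n} → Admissible G s → ∃ (SizedIndep G s) ⊎ degsum G + a * b ≤ n * s)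
  (avoidEdge : ∀ {G : SimpleGraph n} → Admissible G s → ∀ {x y} → Adj G x y →
    (∃[ F ] (SizedIndep G s F × F x ≡ false × F y ≡ false)) ⊎ degsum G + a * b ≤ n * s) where

  private
    Goal : SimpleGraph n → Set
    Goal G = degsum G + a * b ≤ n * s

    m+n≡ : m + n ≡ 3 * s
    m+n≡ = trans (cong₂ _+_ m≡ n≡) (trans (eq a b) (cong (3 *_) (sym s≡)))
      where
      eq : ∀ a b → a + b + (5 * a + 8 * b) ≡ 3 * (2 * a + 3 * b)
      eq = solve-∀

  path-from : ∀ {G A B D C KA NB} → Admissible G s → Indep G A → Indep G B → Indep G D → Indep G C →
    card A ≡ s → card B ≡ s → card D ≡ s → card C ≡ s → Disjoint A B → Disjoint B D → Disjoint D C → Disjoint C KA →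
    Class G KA A → Class G NB B → KA ⊆ B → NB ⊆ A → NB ⊆ D → card KA ≡ m → card NB ≡ m → Goal G
  path-from {G} {A} {B} {D} {C} {KA} {NB} ok indA indB indD indC sizeA sizeB sizeD sizeC A∩B B∩D D∩C C∩KA clA clB KA⊆B NB⊆A NB⊆D sizeKA sizeNB =
    finish (fill Inv D B C (λ (_ , indB , indD , indC , _) → indD , indB , indC) B∩D (disjoint-sym D∩C)
      (λ {G} ok _ z _ _ → subst (deg G z ≤_) (sym sizeD) (deg≤ ok z)) pres m room ok (indA , indB , indD , indC , clA , clB))
    where
    Inv : SimpleGraph n → Set
    Inv G = Indep G A × Indep G B × Indep G D × Indep G C × Class G KA A × Class G NB B
    room : m + n ≤ card B + card C + card D
    room = ≤-reflexive (trans m+n≡ (trans (eq s) (cong₂ _+_ (cong₂ _+_ (sym sizeB) (sym sizeC)) (sym sizeD))))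
      where
      eq : ∀ s → 3 * s ≡ s + s + s
      eq = solve-∀
    pres : ∀ {G} z (z∉D : D z ≡ false) → Inv G → B z ≡ true → C z ≡ true → Inv (redirect G D z z∉D)
    pres {G} z z∉D (indA , indB , indD , indC , clA , clB) Bz Cz =
      redirect-indep {G = G} z∉D indA (inj₁ Az) , redirect-indep {G = G} z∉D indB (inj₂ B∩D) ,
      redirect-indep {G = G} z∉D indD (inj₁ z∉D) , redirect-indep {G = G} z∉D indC (inj₂ (disjoint-sym D∩C)) ,
      class-redirect z∉D clA (≢true (λ h → C∩KA z Cz h)) (λ v h → trans (∉-disjoint {S = B} {D} B∩D (KA⊆B v h)) (sym Az)) ,
      class-redirect z∉D clB (≢true (λ h → A∩B z (NB⊆A z h) Bz)) (λ v h → trans (NB⊆D v h) (sym Bz))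
      where
      Az : A z ≡ false
      Az = ≢true (λ Az → A∩B z Az Bz)
    finish : _ → Goal G
    finish (G' , KD , ok' , (indA , indB , indD , indC , clA , clB) , up , clD , KD⊆B , KD⊆C , sizeKD) =
      ≤-trans (+-monoˡ-≤ (a * b) up) (path-bound {a = a} {b} n≡ s≡ m≡ (record
        { sizeA = sizeA ; sizeB = sizeB ; sizeD = sizeD ; sizeC = sizeC ; A∩B = A∩B ; B∩D = B∩D ; D∩C = D∩C ; C∩KA = C∩KA
        ; KA⊆B = KA⊆B ; NB⊆A = NB⊆A ; NB⊆D = NB⊆D ; KD⊆B = KD⊆B ; KD⊆C = KD⊆C
        ; sizeKA = sizeKA ; sizeNB = sizeNB ; sizeKD = sizeKD }) ok' (record
        { indA = indA ; indB = indB ; indD = indD ; indC = indC ; clA = clA ; clB = clB ; clD = clD }))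

  -- Since `KB` can be exchanged for `C ∩ B`, the set `C ∖ B` has at most `s - m` vertices, so at
  -- least `s` vertices lie outside `B ∪ C` and a partner `D` of `C` can be produced. `D` cannot
  -- miss both `KA` and `KB`, as `2 * s + 2 * m = n + a`. If it meets `KB`, it avoids `B` and
  -- contains `KB`, and the path is `A`, `B`, `D`, `C`; if it meets `KA`, the path is `B`, `A`, `D`,
  -- `C`.
  third-set : ∀ {G A B C KA KB} → Admissible G s → Indep G A → Indep G B → Indep G C → card A ≡ s → card B ≡ s → card C ≡ s →
    Disjoint A B → Class G KA A → Class G KB B → KA ⊆ B → KB ⊆ A → card KA ≡ m → card KB ≡ m →
    Disjoint C KA → Disjoint C KB → Goal G
  third-set {G} {A} {B} {C} {KA} {KB} ok indA indB indC sizeA sizeB sizeC A∩B clA clB KA⊆B KB⊆A sizeKA sizeKB C∩KA C∩KB =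
    -- Starting from `A ∖ C`, the redirected vertices lie outside `C` and outside `A ∖ C`, hence
    -- outside `A`; so `A` stays independent although it may meet `C`.
    finish (connect Inv C W (A ∖ C) Y₀⊆W W∩C s≤W sizeC (λ (_ , _ , indC , _) → indC)
      (λ (indA , _) i j Ai Aj → indA i j (∧-left Ai) (∧-left Aj)) pres ok (indA , indB , indC , clA , clB))
    where
    Inv : SimpleGraph n → Set
    Inv G = Indep G A × Indep G B × Indep G C × Class G KA A × Class G KB B
    W = full ∖ (B ∪ C)
    W-B : ∀ v → W v ≡ true → B v ≡ false
    W-B v h = ≢true (λ Bv → not-true (∧-right {true} h) (∨-left Bv))
    W∩C : Disjoint W C
    W∩C v h Cv = not-true (∧-right {true} h) (∨-right {B v} Cv)
    Y₀⊆W : A ∖ C ⊆ W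
    Y₀⊆W v h = cong not (cong₂ _∨_ (∉-disjoint {S = A} {B} A∩B (∧-left h)) (≢true (not-true (∧-right {A v} h))))
    s≤W : s ≤ card W
    s≤W = linear 0 (+-mono-≤ (+-mono-≤ exchange (≤-reflexive (sym m+n≡))) count)
      (arith s m n (card W) (card (C ∖ B)))
      where
      exchange : card (C ∖ B) + m ≤ s
      exchange = subst (λ k → card (C ∖ B) + k ≤ s) sizeKB (class-exchange ok clB indC C∩KB)
      count : n ≤ card W + (s + card (C ∖ B))
      count = subst₂ _≤_ (trans (+-identityʳ _) (card-full n)) (cong (card W +_) (cong₂ _+_ sizeB (+-identityʳ _)))
        (cards-mono (full ∷ []) (W ∷ B ∷ C ∖ B ∷ []) (λ v → at (B v) (C v)))
        where
        at : ∀ x y → 1 ≤ bit (true ∧ not (x ∨ y)) + (bit x + (bit (y ∧ not x) + 0))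
        at true _ = s≤s z≤n
        at false true = s≤s z≤n
        at false false = s≤s z≤n
      arith : ∀ s m n w x → s + (s + (m + n) + (w + (s + x))) + 0 ≡ w + (x + m + 3 * s + n)
      arith = solve-∀
    pres : ∀ {G} z (z∉C : C z ≡ false) → Inv G → W z ≡ true → (A ∖ C) z ≡ false → Inv (redirect G C z z∉C)
    pres {G} z z∉C (indA , indB , indC , clA , clB) Wz notA =
      redirect-indep {G = G} z∉C indA (inj₁ Az) , redirect-indep {G = G} z∉C indB (inj₁ Bz) ,
      redirect-indep {G = G} z∉C indC (inj₁ z∉C) ,
      class-redirect z∉C clA (≢true (λ h → false≢true Bz (KA⊆B z h))) (λ v h → trans (≢true (λ Cv → C∩KA v Cv h)) (sym Az)) ,
      class-redirect z∉C clB (≢true (λ h → false≢true Az (KB⊆A z h))) (λ v h → trans (≢true (λ Cv → C∩KB v Cv h)) (sym Bz))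
      where
      Bz : B z ≡ false
      Bz = W-B z Wz
      Az : A z ≡ false
      Az = ≢true (λ Az → false≢true notA (∖-∈ {S = A} {C} Az z∉C))
    finish : _ → Goal G
    finish (G' , D , ok' , (indA , indB , indC , clA , clB) , up , indD , sizeD , D∩C) = ≤-trans (+-monoˡ-≤ (a * b) up)
      (branch (any? (λ v → true? ((D ∩ KB) v))) (any? (λ v → true? ((D ∩ KA) v))))
      where
      branch : Dec (∃[ v ] (D ∩ KB) v ≡ true) → Dec (∃[ v ] (D ∩ KA) v ≡ true) → Goal G'
      branch (yes (v , h)) _ = path-from ok' indA indB indD indC sizeA sizeB sizeD sizeC A∩B (disjoint-sym D∩B) D∩C C∩KA
        clA clB KA⊆B KB⊆A (class-absorbed ok' clB (indD , sizeD) D∩B) sizeKA sizeKB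
        where
        D∩B : Disjoint D B
        D∩B = meets⇒disjoint clB indD (∧-right {D v} h) (∧-left h)
      branch (no _) (yes (v , h)) = path-from ok' indB indA indD indC sizeB sizeA sizeD sizeC (disjoint-sym A∩B) (disjoint-sym D∩A) D∩C C∩KB
        clB clA KB⊆A KA⊆B (class-absorbed ok' clA (indD , sizeD) D∩A) sizeKB sizeKA
        where
        D∩A : Disjoint D A
        D∩A = meets⇒disjoint clA indD (∧-right {D v} h) (∧-left h)
      branch (no noB) (no noA) = ⊥-elim (overfull {a} {b} n≡ s≡ m≡ 1≤a
        (subst (_≤ n) (cong₂ _+_ sizeD (cong₂ _+_ sizeC (cong₂ _+_ sizeKA (cong (_+ 0) sizeKB))))
          (packing (D ∷ C ∷ KA ∷ KB ∷ [])
            ((D∩C ∷ (λ v Dv Kv → noA (v , ∧-both Dv Kv)) ∷ (λ v Dv Kv → noB (v , ∧-both Dv Kv)) ∷ []) ∷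
             (C∩KA ∷ C∩KB ∷ []) ∷ (disjoint-sym (disjoint-⊆ KB⊆A KA⊆B A∩B) ∷ []) ∷ [] ∷ []))))

  bound : ∀ {G} → Admissible G s → Goal G
  bound {G} ok = start (largeSet ok)
    where
    Pair : VertexSet n → VertexSet n → SimpleGraph n → Set
    Pair A B G = Indep G A × Indep G B
    Pair₁ : VertexSet n → VertexSet n → VertexSet n → SimpleGraph n → Set
    Pair₁ A B KA G = Pair A B G × Class G KA A

    room : ∀ (A B : VertexSet n) → card A ≡ s → card B ≡ s → m + n ≤ card B + card B + card A
    room A B sizeA sizeB = ≤-reflexive (trans m+n≡ (trans (eq s) (cong₂ (λ x y → y + y + x) (sym sizeA) (sym sizeB))))
      where
      eq : ∀ s → 3 * s ≡ s + s + s
      eq = solve-∀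

    withClasses : ∀ {A B KA G} → Admissible G s → Pair₁ A B KA G → card A ≡ s → card B ≡ s → Disjoint A B → KA ⊆ B → card KA ≡ m →
      ∀ {KB} → Class G KB B → KB ⊆ A → card KB ≡ m → Goal G
    withClasses {A} {B} {KA} {G} ok ((indA , indB) , clA) sizeA sizeB A∩B KA⊆B sizeKA {KB} clB KB⊆A sizeKB =
      atEdge (member KA (nonempty KA sizeKA)) (member KB (nonempty KB sizeKB))
      where
      nonempty : ∀ (K : VertexSet n) → card K ≡ m → 0 < card K
      nonempty K size = ≤-trans 1≤a (≤-trans (m≤m+n a b) (≤-reflexive (trans (sym m≡) (sym size))))
      atEdge : ∃[ y ] KA y ≡ true → ∃[ x ] KB x ≡ true → Goal G
      atEdge (y , KAy) (x , KBx) = handle (avoidEdge ok (trans (nbhd clB x y KBx) (KA⊆B y KAy)))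
        where
        handle : _ → Goal G
        handle (inj₂ goal) = goal
        -- An `s`-set that met `KA` would contain all of it, `y` included, and likewise for `KB` and
        -- `x`; so omitting one vertex of each class means omitting both classes.
        handle (inj₁ (C , (indC , sizeC) , Cx , Cy)) = third-set ok indA indB indC sizeA sizeB sizeC A∩B clA clB KA⊆B KB⊆A sizeKA sizeKB
          (λ v Cv Kv → false≢true Cy (class-absorbed ok clA (indC , sizeC) (meets⇒disjoint clA indC Kv Cv) y KAy))
          (λ v Cv Kv → false≢true Cx (class-absorbed ok clB (indC , sizeC) (meets⇒disjoint clB indC Kv Cv) x KBx))

    withPair : ∀ {A B G} → Admissible G s → Pair A B G → card A ≡ s → card B ≡ s → Disjoint A B → Goal G
    withPair {A} {B} ok pair sizeA sizeB A∩B = first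
      -- With a single partner `B`, taken twice, the room is still `3 * s - n = m`.
      (fill (Pair A B) A B B (λ (indA , indB) → indA , indB , indB) (disjoint-sym A∩B) (disjoint-sym A∩B)
        (λ {G} ok _ z _ _ → subst (deg G z ≤_) (sym sizeA) (deg≤ ok z))
        (λ {G} z z∉A (indA , indB) _ _ → redirect-indep {G = G} z∉A indA (inj₁ z∉A) , redirect-indep {G = G} z∉A indB (inj₂ (disjoint-sym A∩B)))
        m (room A B sizeA sizeB) ok pair)
      where
      first : _ → _
      first (G₁ , KA , ok₁ , pair₁ , up₁ , clA , KA⊆B , _ , sizeKA) = ≤-trans (+-monoˡ-≤ (a * b) up₁) (second
        (fill (Pair₁ A B KA) B A A (λ ((indA , indB) , _) → indB , indA , indA) A∩B A∩B
          (λ {G} ok _ z _ _ → subst (deg G z ≤_) (sym sizeB) (deg≤ ok z))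
          (λ {G} z z∉B ((indA , indB) , clA) Az _ → (redirect-indep {G = G} z∉B indA (inj₂ A∩B) , redirect-indep {G = G} z∉B indB (inj₁ z∉B)) ,
            class-redirect z∉B clA (≢true (λ h → false≢true z∉B (KA⊆B z h))) (λ v h → trans (KA⊆B v h) (sym Az)))
          m (room B A sizeB sizeA) ok₁ (pair₁ , clA)))
        where
        second : _ → Goal G₁
        second (G₂ , KB , ok₂ , pair₂ , up₂ , clB , KB⊆A , _ , sizeKB) = ≤-trans (+-monoˡ-≤ (a * b) up₂)
          (withClasses ok₂ pair₂ sizeA sizeB A∩B KA⊆B sizeKA clB KB⊆A sizeKB)

    start : ∃ (SizedIndep G s) ⊎ Goal G → Goal G
    start (inj₂ goal) = goal
    start (inj₁ (A , indA , sizeA)) = finish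
      (connect (λ G → Indep G A) A (full ∖ A) ∅ (λ _ ()) (λ v h → not-true (∧-right {true} h)) s≤W sizeA (λ ind → ind) (λ _ _ _ ())
        (λ {G} z z∉A indA _ _ → redirect-indep {G = G} z∉A indA (inj₁ z∉A)) ok indA)
      where
      s≤W : s ≤ card (full ∖ A)
      s≤W = linear (a + 2 * b) (subst₂ _≤_ (card-full n) (cong (card (full ∖ A) +_) (trans (card-cong {S = full ∩ A} {A} (λ _ → refl)) sizeA)) (card-∖-∩ full A))
        (trans (cong (λ x → x + (card (full ∖ A) + x) + (a + 2 * b)) s≡) (trans (eq a b (card (full ∖ A))) (cong (card (full ∖ A) +_) (sym n≡))))
        where
        eq : ∀ a b w → 2 * a + 3 * b + (w + (2 * a + 3 * b)) + (a + 2 * b) ≡ w + (5 * a + 8 * b)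
        eq = solve-∀
      finish : _ → Goal G
      finish (G' , B , ok' , indA , up , indB , sizeB , B∩A) = ≤-trans (+-monoˡ-≤ (a * b) up)
        (withPair ok' (indA , indB) sizeA sizeB (disjoint-sym B∩A))

-- Induction

-- Twice the bound of the theorem, with the negative term on the left. It is asked of all `n` and
-- `s`, since the two recursive calls lower `a` by 2 and by 8 and may leave the interval.
DegreeBound : ℕ → ℕ → Set
DegreeBound n s = (G : SimpleGraph n) → Admissible G s → degsum G + 30 * (n * s) ≤ 6 * (n * n) + 40 * (s * s)

-- `6n² - 31ns + 40s² = (2n - 5s)(3n - 8s)`, so the bound equals `n * s + p * q` and the trivial
-- `n * s` suffices. The next lemma treats the same product with both factors reversed in sign.
outer-bound : ∀ {n s} p q → 2 * n ≡ 5 * s + p → 3 * n ≡ 8 * s + q → DegreeBound n s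
outer-bound {n} {s} p q e₁ e₂ G ok = linear (p * q) (+-mono-≤ (degsum≤ ok) (≤-reflexive total))
  (eq n s p q (degsum G))
  where
  eq : ∀ n s p q d → d + 30 * (n * s) + (n * s + (6 * (n * n) + 40 * (s * s))) + p * q ≡
    6 * (n * n) + 40 * (s * s) + (d + (31 * (n * s) + p * q))
  eq = solve-∀
  total : 31 * (n * s) + p * q ≡ 6 * (n * n) + 40 * (s * s)
  total = +-cancelʳ-≡ (40 * (s * s)) _ _ (begin
    31 * (n * s) + p * q + 40 * (s * s)
      ≡⟨ split n s p q ⟩
    8 * s * (2 * n) + 5 * s * (3 * n) + p * q + 40 * (s * s)
      ≡⟨ cong₂ (λ x y → 8 * s * x + 5 * s * y + p * q + 40 * (s * s)) e₁ e₂ ⟩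
    8 * s * (5 * s + p) + 5 * s * (8 * s + q) + p * q + 40 * (s * s)
      ≡⟨ regroup s p q ⟩
    (5 * s + p) * (8 * s + q) + 40 * (s * s) + 40 * (s * s)
      ≡⟨ cong₂ (λ x y → x * y + 40 * (s * s) + 40 * (s * s)) (sym e₁) (sym e₂) ⟩
    2 * n * (3 * n) + 40 * (s * s) + 40 * (s * s)
      ≡⟨ last n s ⟩
    6 * (n * n) + 40 * (s * s) + 40 * (s * s) ∎)
    where
    open ≡-Reasoning
    split : ∀ n s p q → 31 * (n * s) + p * q + 40 * (s * s) ≡ 8 * s * (2 * n) + 5 * s * (3 * n) + p * q + 40 * (s * s)
    split = solve-∀
    regroup : ∀ s p q → 8 * s * (5 * s + p) + 5 * s * (8 * s + q) + p * q + 40 * (s * s) ≡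
      (5 * s + p) * (8 * s + q) + 40 * (s * s) + 40 * (s * s)
    regroup = solve-∀
    last : ∀ n s → 2 * n * (3 * n) + 40 * (s * s) + 40 * (s * s) ≡ 6 * (n * n) + 40 * (s * s) + 40 * (s * s)
    last = solve-∀

outer-bound′ : ∀ {n s} p q → 5 * s ≡ 2 * n + p → 8 * s ≡ 3 * n + q → DegreeBound n s
outer-bound′ {n} {s} p q e₁ e₂ G ok = linear (p * q) (+-mono-≤ (degsum≤ ok) (≤-reflexive total))
  (eq n s p q (degsum G))
  where
  eq : ∀ n s p q d → d + 30 * (n * s) + (n * s + (6 * (n * n) + 40 * (s * s))) + p * q ≡
    6 * (n * n) + 40 * (s * s) + (d + (31 * (n * s) + p * q))
  eq = solve-∀
  total : 31 * (n * s) + p * q ≡ 6 * (n * n) + 40 * (s * s)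
  total = begin
    31 * (n * s) + p * q
      ≡⟨ split n s p q ⟩
    3 * n * (5 * s) + 2 * n * (8 * s) + p * q
      ≡⟨ cong₂ (λ x y → 3 * n * x + 2 * n * y + p * q) e₁ e₂ ⟩
    3 * n * (2 * n + p) + 2 * n * (3 * n + q) + p * q
      ≡⟨ regroup n p q ⟩
    6 * (n * n) + (2 * n + p) * (3 * n + q)
      ≡⟨ cong₂ (λ x y → 6 * (n * n) + x * y) (sym e₁) (sym e₂) ⟩
    6 * (n * n) + 5 * s * (8 * s)
      ≡⟨ last n s ⟩
    6 * (n * n) + 40 * (s * s) ∎
    where
    open ≡-Reasoning
    split : ∀ n s p q → 31 * (n * s) + p * q ≡ 3 * n * (5 * s) + 2 * n * (8 * s) + p * q
    split = solve-∀
    regroup : ∀ n p q → 3 * n * (2 * n + p) + 2 * n * (3 * n + q) + p * q ≡ 6 * (n * n) + (2 * n + p) * (3 * n + q)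
    regroup = solve-∀
    last : ∀ n s → 6 * (n * n) + 5 * s * (8 * s) ≡ 6 * (n * n) + 40 * (s * s)
    last = solve-∀

-- The matrix from `(a , b)` to `(n , s)` has determinant `-1`. Its inverse is integral, so the
-- blow-up exists for all `n` and `s` in the interval, without divisibility conditions.
parameters : ∀ {n s a b} → 8 * s ≡ 3 * n + a → 2 * n ≡ 5 * s + b → n ≡ 5 * a + 8 * b × s ≡ 2 * a + 3 * b
parameters {n} {s} {a} {b} e₁ e₂ =
  +-cancelʳ-≡ (15 * n + 40 * s) n (5 * a + 8 * b) (trans (l₁ n s) (trans (cong₂ (λ x y → 8 * x + 5 * y) e₂ e₁) (l₂ n s a b))) ,
  +-cancelʳ-≡ (15 * s + 6 * n) s (2 * a + 3 * b) (trans (l₃ n s) (trans (cong₂ (λ x y → 2 * x + 3 * y) e₁ e₂) (l₄ n s a b)))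
  where
  l₁ : ∀ n s → n + (15 * n + 40 * s) ≡ 8 * (2 * n) + 5 * (8 * s)
  l₁ = solve-∀
  l₂ : ∀ n s a b → 8 * (5 * s + b) + 5 * (3 * n + a) ≡ 5 * a + 8 * b + (15 * n + 40 * s)
  l₂ = solve-∀
  l₃ : ∀ n s → s + (15 * s + 6 * n) ≡ 2 * (8 * s) + 3 * (2 * n)
  l₃ = solve-∀
  l₄ : ∀ n s a b → 2 * (3 * n + a) + 3 * (5 * s + b) ≡ 2 * a + 3 * b + (15 * s + 6 * n)
  l₄ = solve-∀

-- The positive parameters are `suc a` and `suc b`; with two vertices and one unit of `s` removed,
-- the constants are `11 = 5 + 8 - 2` and `4 = 2 + 3 - 1`.
small-arith : ∀ a b {n₂ t d} → n₂ ≡ 11 + (5 * a + 8 * b) → t ≡ 4 + (2 * a + 3 * b) →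
  d + 30 * (n₂ * t) ≤ 6 * (n₂ * n₂) + 40 * (t * t) →
  d + (10 * suc a + 12 * suc b) ≤ 10 * (suc a * suc a) + 30 * (suc a * suc b) + 24 * (suc b * suc b) + 4
small-arith a b {d = d} refl refl h = linear 0 h (eq a b d)
  where
  eq : ∀ a b d → let n₂ = 11 + (5 * a + 8 * b); t = 4 + (2 * a + 3 * b) in
    d + (10 * suc a + 12 * suc b) + (6 * (n₂ * n₂) + 40 * (t * t)) + 0 ≡
    10 * (suc a * suc a) + 30 * (suc a * suc b) + 24 * (suc b * suc b) + 4 + (d + 30 * (n₂ * t))
  eq = solve-∀

goal-arith : ∀ {a b n s d} → n ≡ 5 * a + 8 * b → s ≡ 2 * a + 3 * b →
  d + a * b ≤ n * s → d + 30 * (n * s) ≤ 6 * (n * n) + 40 * (s * s)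
goal-arith {a} {b} {d = d} refl refl h = linear 0 h (eq a b d)
  where
  eq : ∀ a b d → let n = 5 * a + 8 * b; s = 2 * a + 3 * b in
    d + 30 * (n * s) + n * s + 0 ≡ 6 * (n * n) + 40 * (s * s) + (d + a * b)
  eq = solve-∀

-- With a ≥ 4 the bound for s − 1 is stronger than that for s; with a < 4 the trivial bound n(s − 1) is.
sparse-arith : ∀ c b {n t d} → n ≡ 2 + (11 + (5 * (3 + c) + 8 * b)) → t ≡ 4 + (2 * (3 + c) + 3 * b) →
  d + 30 * (n * t) ≤ 6 * (n * n) + 40 * (t * t) → d + suc (3 + c) * suc b ≤ n * suc t
sparse-arith c b {d = d} refl refl h = linear (10 * c) h (eq c b d)
  where
  eq : ∀ c b d → let a = 3 + c; n = 2 + (11 + (5 * a + 8 * b)); t = 4 + (2 * a + 3 * b) in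
    d + suc a * suc b + (6 * (n * n) + 40 * (t * t)) + 10 * c ≡ n * suc t + (d + 30 * (n * t))
  eq = solve-∀

sparse-arith′ : ∀ a b {n t d} → n ≡ 2 + (11 + (5 * a + 8 * b)) → suc a ≤ 3 → d ≤ n * t → d + suc a * suc b ≤ n * suc t
sparse-arith′ a b {t = t} {d} refl a<3 h = linear (10 + 5 * a + 5 * b) (+-mono-≤ h (*-monoˡ-≤ (suc b) a<3)) (eq a b t d)
  where
  eq : ∀ a b t d → let n = 2 + (11 + (5 * a + 8 * b)) in
    d + suc a * suc b + (n * t + 3 * suc b) + (10 + 5 * a + 5 * b) ≡ n * suc t + (d + suc a * suc b)
  eq = solve-∀

module _ (a b : ℕ) {n₂ t : ℕ} (n₂≡ : n₂ ≡ 11 + (5 * a + 8 * b)) (t≡ : t ≡ 4 + (2 * a + 3 * b))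
  (smaller : DegreeBound n₂ t) (sparser : DegreeBound (suc (suc n₂)) t) where

  private
    Goal : SimpleGraph (suc (suc n₂)) → Set
    Goal G = degsum G + suc a * suc b ≤ suc (suc n₂) * suc t

    n≡ : suc (suc n₂) ≡ 5 * suc a + 8 * suc b
    n≡ = trans (cong (2 +_) n₂≡) (eq a b)
      where
      eq : ∀ a b → 2 + (11 + (5 * a + 8 * b)) ≡ 5 * suc a + 8 * suc b
      eq = solve-∀

    s≡ : suc t ≡ 2 * suc a + 3 * suc b
    s≡ = trans (cong suc t≡) (eq a b)
      where
      eq : ∀ a b → 1 + (4 + (2 * a + 3 * b)) ≡ 2 * suc a + 3 * suc b
      eq = solve-∀

    fewer : ∀ G → Admissible G t → Goal G
    fewer G ok with 3 ≤? a
    ... | no 3≰a = sparse-arith′ a b {suc (suc n₂)} {t} (cong (2 +_) n₂≡) (≰⇒> 3≰a) (degsum≤ ok)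
    ... | yes 3≤a = subst (λ a → n₂ ≡ 11 + (5 * a + 8 * b) → t ≡ 4 + (2 * a + 3 * b) → degsum G + suc a * suc b ≤ suc (suc n₂) * suc t)
      (m+[n∸m]≡n 3≤a) (λ n₂≡ t≡ → sparse-arith (a ∸ 3) b {suc (suc n₂)} {t} (cong (2 +_) n₂≡) t≡ (sparser G ok)) n₂≡ t≡

    largeSet : ∀ {G} → Admissible G (suc t) → ∃ (SizedIndep G (suc t)) ⊎ Goal G
    largeSet {G} ok with search (SizedIndep G (suc t)) (λ S → indep? G S ×-dec (card S ℕ.≟ suc t))
      (λ eq (ind , size) → Indep-cong {G = G} eq ind , trans (sym (card-cong eq)) size)
    ... | yes found = inj₁ found
    ... | no none = inj₂ (fewer G (record { triangleFree = triangleFree ok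
      ; indep≤ = λ S ind → ≤-pred (≤∧≢⇒< (indep≤ ok S ind) (λ e → none (S , ind , e))) }))

    avoidEdge : ∀ {G} → Admissible G (suc t) → ∀ {x y} → Adj G x y →
      (∃[ F ] (SizedIndep G (suc t) F × F x ≡ false × F y ≡ false)) ⊎ Goal G
    avoidEdge {G} ok xy with delete-edge ok xy
    ... | inj₁ found = inj₁ found
    ... | inj₂ (H , okH , count) = inj₂ (edge-arith {suc a} {suc b} {dH = degsum H} n≡ s≡ (s≤s z≤n) count
      (small-arith a b n₂≡ t≡ (smaller H okH)))

  inner-bound : DegreeBound (suc (suc n₂)) (suc t)
  inner-bound G ok = goal-arith {suc a} {suc b} {suc (suc n₂)} {suc t} n≡ s≡ (bound {a = suc a} {suc b} n≡ s≡ refl (s≤s z≤n) largeSet avoidEdge ok)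

-- `8 * s ≤ 3 * n` forces `5 * s ≤ 2 * n`, and `2 * n ≤ 5 * s` forces `3 * n ≤ 8 * s`; so the
-- product of the two parameters is not positive in the first two cases. The recursion goes to
-- `(n - 2 , s - 1)` and `(n , s - 1)`, hence the measure `n + s`.
degree-bound : ∀ N n s → n + s ≤ N → DegreeBound n s
degree-bound zero zero zero _ = outer-bound 0 0 refl refl
degree-bound (suc N) n s n+s≤N with 8 * s ≤? 3 * n | 2 * n ≤? 5 * s
... | yes 8s≤3n | _ = outer-bound (2 * n ∸ 5 * s) (3 * n ∸ 8 * s) (sym (m+[n∸m]≡n 5s≤2n)) (sym (m+[n∸m]≡n 8s≤3n))
  where
  5s≤2n : 5 * s ≤ 2 * n
  5s≤2n = *-cancelˡ-≤ 3 (linear s (*-monoʳ-≤ 2 8s≤3n) (eq n s))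
    where
    eq : ∀ n s → 3 * (5 * s) + 2 * (3 * n) + s ≡ 3 * (2 * n) + 2 * (8 * s)
    eq = solve-∀
... | no _ | yes 2n≤5s = outer-bound′ (5 * s ∸ 2 * n) (8 * s ∸ 3 * n) (sym (m+[n∸m]≡n 2n≤5s)) (sym (m+[n∸m]≡n 3n≤8s))
  where
  3n≤8s : 3 * n ≤ 8 * s
  3n≤8s = *-cancelˡ-≤ 2 (linear s (*-monoʳ-≤ 3 2n≤5s) (eq n s))
    where
    eq : ∀ n s → 2 * (3 * n) + 3 * (5 * s) + s ≡ 2 * (8 * s) + 3 * (2 * n)
    eq = solve-∀
... | no 8s≰3n | no 2n≰5s = inside (positive (≰⇒> 8s≰3n)) (positive (≰⇒> 2n≰5s))
  where
  positive : ∀ {x y} → x < y → ∃[ d ] y ≡ x + suc d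
  positive {x} {y} x<y = y ∸ suc x , sym (trans (+-suc x (y ∸ suc x)) (m+[n∸m]≡n x<y))
  inside : ∃[ a ] 8 * s ≡ 3 * n + suc a → ∃[ b ] 2 * n ≡ 5 * s + suc b → DegreeBound n s
  inside (a , e₁) (b , e₂) = go refl refl (trans (proj₁ ns) (n-form a b)) (trans (proj₂ ns) (s-form a b))
    where
    ns = parameters {n} {s} {suc a} {suc b} e₁ e₂
    n-form : ∀ a b → 5 * suc a + 8 * suc b ≡ 2 + (11 + (5 * a + 8 * b))
    n-form = solve-∀
    s-form : ∀ a b → 2 * suc a + 3 * suc b ≡ 1 + (4 + (2 * a + 3 * b))
    s-form = solve-∀
    go : ∀ {n₂ t} → n₂ ≡ 11 + (5 * a + 8 * b) → t ≡ 4 + (2 * a + 3 * b) → n ≡ 2 + n₂ → s ≡ 1 + t → DegreeBound n s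
    go {n₂} {t} n₂≡ t≡ refl refl = inner-bound a b n₂≡ t≡
      (degree-bound N n₂ t (≤-trans (m≤n+m (n₂ + t) 2) lower)) (degree-bound N (2 + n₂) t lower)
      where
      lower : 2 + n₂ + t ≤ N
      lower = ≤-pred (subst (_≤ suc N) (+-suc (2 + n₂) t) n+s≤N)

-- From degree sums to edge counts and to the integers

sum-map-allFin : ∀ {n} (f : Fin n → ℕ) → ListAction.sum (List.map f (List.allFin n)) ≡ ∑ f
sum-map-allFin {n} f = trans (cong ListAction.sum (List.map-tabulate {n = n} (λ v → v) f)) (tab f)
  where
  tab : ∀ {n} (f : Fin n → ℕ) → ListAction.sum (List.tabulate f) ≡ ∑ f
  tab {zero}  f = refl
  tab {suc n} f = cong (f zero +_) (tab (f ∘ suc))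

degsum≡2edgeCount : ∀ {n} (G : SimpleGraph n) → degsum G ≡ edgeCount G + edgeCount G
degsum≡2edgeCount {n} G = begin
  ∑ (λ i → ∑ (λ j → bit (adj G i j)))
    ≡⟨ sum-cong-≗ {n} (λ i → trans (sum-cong-≗ {n} (orient i)) (∑-distrib-+ (λ j → bit (below i j)) (λ j → bit (below j i)))) ⟩
  ∑ (λ i → ∑ (λ j → bit (below i j)) + ∑ (λ j → bit (below j i)))
    ≡⟨ ∑-distrib-+ (λ i → ∑ (λ j → bit (below i j))) (λ i → ∑ (λ j → bit (below j i))) ⟩
  ∑ (λ i → ∑ (λ j → bit (below i j))) + ∑ (λ i → ∑ (λ j → bit (below j i)))
    ≡⟨ cong₂ _+_ refl (∑-comm {n} {n} (λ i j → bit (below j i))) ⟩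
  ∑ (λ i → ∑ (λ j → bit (below i j))) + ∑ (λ i → ∑ (λ j → bit (below i j)))
    ≡⟨ cong₂ _+_ (sym edges) (sym edges) ⟩
  edgeCount G + edgeCount G ∎
  where
  open ≡-Reasoning
  below : Fin n → Fin n → Bool
  below i j = (toℕ j <ᵇ toℕ i) ∧ adj G i j
  edges : edgeCount G ≡ ∑ (λ i → ∑ (λ j → bit (below i j)))
  edges = trans (sum-map-allFin {n} _) (sum-cong-≗ {n} (λ i → trans (sum-map-allFin {n} _) (sum-cong-≗ {n} (λ j → conv (below i j)))))
    where
    conv : ∀ b → (if b then 1 else 0) ≡ bit b
    conv true = refl
    conv false = refl
  <ᵇ-true : ∀ {x y} → x < y → (x <ᵇ y) ≡ true
  <ᵇ-true {x} {y} lt = T⇒ (<⇒<ᵇ lt)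
    where
    T⇒ : ∀ {b} → T b → b ≡ true
    T⇒ {true} _ = refl
  <ᵇ-false : ∀ {x y} → ¬ x < y → (x <ᵇ y) ≡ false
  <ᵇ-false {x} {y} nlt = ≢true (λ e → nlt (<ᵇ⇒< x y (subst T (sym e) _)))
  orient : ∀ i j → bit (adj G i j) ≡ bit (below i j) + bit (below j i)
  orient i j with <-cmp (toℕ i) (toℕ j)
  ... | tri< lt _ nlt rewrite <ᵇ-true lt | <ᵇ-false nlt = cong bit (SimpleGraph.sym G i j)
  ... | tri> nlt _ lt rewrite <ᵇ-true lt | <ᵇ-false nlt = sym (+-identityʳ _)
  ... | tri≈ nlt e ngt rewrite <ᵇ-false nlt | <ᵇ-false ngt | toℕ-injective e = cong bit (irrefl G j)

card-tabulate : ∀ {n} (S : VertexSet n) → ∣ tabulate S ∣ ≡ card S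
card-tabulate {zero} S = refl
card-tabulate {suc n} S with S zero
... | true  = cong suc (card-tabulate (S ∘ suc))
... | false = card-tabulate (S ∘ suc)

admissible : ∀ {n s} {G : SimpleGraph n} → TriangleFree G → IndepNumberAtMost G s → Admissible G s
admissible {s = s} {G} tf bounded = record
  { triangleFree = tf
  ; indep≤ = λ S ind → subst (_≤ s) (card-tabulate S)
      (bounded (tabulate S) (λ i j Si Sj → ind i j (in-S S Si) (in-S S Sj)))
  }
  where
  in-S : ∀ S {i} → i ∈ tabulate S → S i ≡ true
  in-S S {i} h = trans (sym (lookup∘tabulate S i)) ([]=⇒lookup h)

admissible⁻¹ : ∀ {n s} {G : SimpleGraph n} → Admissible G s → IndepNumberAtMost G s
admissible⁻¹ {s = s} ok S ind = subst (_≤ s) size (indep≤ ok (lookup S) (λ i j Si Sj → ind i j (lookup⇒[]= i S Si) (lookup⇒[]= j S Sj)))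
  where
  size : card (lookup S) ≡ ∣ S ∣
  size = trans (sym (card-tabulate (lookup S))) (cong ∣_∣ (tabulate∘lookup S))

edge-bound : ∀ {n s} {G : SimpleGraph n} → TriangleFree G → IndepNumberAtMost G s →
  edgeCount G + 15 * n * s ≤ 3 * n * n + 20 * s * s
edge-bound {n} {s} {G} tf bounded = *-cancelˡ-≤ 2 (linear 0
  (≤-trans (≤-reflexive (cong (_+ 30 * (n * s)) (sym (degsum≡2edgeCount G)))) (degree-bound (n + s) n s ≤-refl G (admissible tf bounded)))
  (eq (edgeCount G) n s))
  where
  eq : ∀ e n s → 2 * (e + 15 * n * s) + (6 * (n * n) + 40 * (s * s)) + 0 ≡ 2 * (3 * n * n + 20 * s * s) + (e + e + 30 * (n * s))
  eq = solve-∀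

edge-bound-ℤ : ∀ n s → (pos 3 *ℤ pos n *ℤ pos n) -ℤ (pos 15 *ℤ pos n *ℤ pos s) +ℤ (pos 20 *ℤ pos s *ℤ pos s) ≡
  (3 * n * n + 20 * s * s) ⊖ (15 * n * s)
edge-bound-ℤ n s = trans
  (cong₂ _+ℤ_ (trans (cong₂ _-ℤ_ (product 3 n n) (product 15 n s)) (ℤ.[+m]-[+n]≡m⊖n (3 * n * n) (15 * n * s))) (product 20 s s))
  (ℤ.distribˡ-⊖-+-pos (20 * s * s) (3 * n * n) (15 * n * s))
  where
  product : ∀ x y z → pos x *ℤ pos y *ℤ pos z ≡ pos (x * y * z)
  product x y z = trans (cong (_*ℤ pos z) (sym (ℤ.pos-* x y))) (sym (ℤ.pos-* (x * y) z))

pos≡⊖ : ∀ x y → pos x ≡ (x + y) ⊖ y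
pos≡⊖ x y = trans (cong pos (sym (m+n∸n≡m x y))) (sym (ℤ.⊖-≥ (m≤n+m y x)))

-- The extremal graphs

∑-++ : ∀ m k (f : Fin (m + k) → ℕ) → ∑ f ≡ ∑ (λ i → f (i ↑ˡ k)) + ∑ (λ j → f (m ↑ʳ j))
∑-++ zero    k f = refl
∑-++ (suc m) k f = trans (cong (f zero +_) (∑-++ m k (f ∘ suc))) (sym (+-assoc (f zero) _ _))

∑-combine : ∀ a k (f : Fin (a * k) → ℕ) → ∑ f ≡ ∑ {a} (λ i → ∑ {k} (λ j → f (combine i j)))
∑-combine zero    k f = refl
∑-combine (suc a) k f = trans (∑-++ k (a * k) f) (cong (∑ (λ j → f (j ↑ˡ (a * k))) +_) (∑-combine a k (λ i → f (k ↑ʳ i))))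

-- Circulant on the residues modulo 8 with differences 3, 4, 5; multiplication by 3 turns it into
-- the 8-cycle with its four long diagonals.
wagner : SimpleGraph 8
wagner = record
  { adj    = λ i j → (3 ≤ᵇ ∣ toℕ i - toℕ j ∣) ∧ (∣ toℕ i - toℕ j ∣ ≤ᵇ 5)
  ; sym    = λ i j → cong (λ d → (3 ≤ᵇ d) ∧ (d ≤ᵇ 5)) (∣-∣-comm (toℕ i) (toℕ j))
  ; irrefl = λ i → cong (λ d → (3 ≤ᵇ d) ∧ (d ≤ᵇ 5)) (∣n-n∣≡0 (toℕ i))
  }

-- The blow-up has parts of size a + b on the pentagon 0, 3, 6, 1, 4 of the Wagner graph and of size b elsewhere.
heavy : Fin 5 → Fin 8
heavy 0F = 0F
heavy 1F = 1F
heavy 2F = 3F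
heavy 3F = 4F
heavy 4F = 6F

induced : ∀ {m n} → SimpleGraph m → (Fin n → Fin m) → SimpleGraph n
induced G f = record
  { adj    = λ i j → adj G (f i) (f j)
  ; sym    = λ i j → SimpleGraph.sym G (f i) (f j)
  ; irrefl = λ i → irrefl G (f i)
  }

wagner-triangleFree : TriangleFree wagner
wagner-triangleFree i j k ij jk ik = toWitness {a? = all? λ i → all? λ j → all? λ k →
  true? (adj wagner i j) →-dec (true? (adj wagner j k) →-dec ¬? (true? (adj wagner i k)))} _ i j k ij jk ik

small-indep : ∀ {n s} (G : SimpleGraph n) → ¬ ∃ (λ (S : Subset n) → Indep G (lookup S) × s < card (lookup S)) →
  ∀ S → Indep G S → card S ≤ s
small-indep {s = s} G none S ind = ≮⇒≥ (λ lt → none (tabulate S ,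
  Indep-cong {G = G} (λ v → sym (lookup∘tabulate S v)) ind ,
  subst (s <_) (card-cong (λ v → sym (lookup∘tabulate S v))) lt))

wagner-indep : ∀ S → Indep wagner S → card S ≤ 3
wagner-indep = small-indep wagner
  (from-no (anySubset? (λ S → indep? wagner (lookup S) ×-dec (4 ≤? card (lookup S)))))

heavy-indep : ∀ S → Indep (induced wagner heavy) S → card S ≤ 2
heavy-indep = small-indep (induced wagner heavy)
  (from-no (anySubset? (λ S → indep? (induced wagner heavy) (lookup S) ×-dec (3 ≤? card (lookup S)))))

module _ (a b : ℕ) where

  private
    n = a * 5 + b * 8

  -- The vertices come as `a` blocks of five and `b` blocks of eight. Each block meets a part at
  -- most once, so the blow-up induces on it the pentagon or the whole Wagner graph; an independent
  -- set therefore has at most 2 or 3 vertices per block, `2 * a + 3 * b` in all.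
  part : Fin n → Fin 8
  part v = [ (λ i → heavy (proj₂ (remQuot {a} 5 i))) , (λ i → proj₂ (remQuot {b} 8 i)) ]′ (splitAt (a * 5) v)

  private
    left : Fin a → Fin 5 → Fin n
    left i j = combine i j ↑ˡ (b * 8)
    right : Fin b → Fin 8 → Fin n
    right i j = (a * 5) ↑ʳ combine i j

    part-left : ∀ i j → part (left i j) ≡ heavy j
    part-left i j = trans (cong [ _ , _ ]′ (splitAt-↑ˡ (a * 5) (combine i j) (b * 8))) (cong (heavy ∘ proj₂) (remQuot-combine i j))
    part-right : ∀ i j → part (right i j) ≡ j
    part-right i j = trans (cong [ _ , _ ]′ (splitAt-↑ʳ (a * 5) (b * 8) (combine i j))) (cong proj₂ (remQuot-combine i j))

    blocks : ∀ f → ∑ f ≡ ∑ {a} (λ i → ∑ (λ j → f (left i j))) + ∑ {b} (λ i → ∑ (λ j → f (right i j)))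
    blocks f = trans (∑-++ (a * 5) (b * 8) f)
      (cong₂ _+_ (∑-combine a 5 (λ i → f (i ↑ˡ (b * 8)))) (∑-combine b 8 (λ i → f ((a * 5) ↑ʳ i))))

    blocks-part : ∀ (g : Fin 8 → ℕ) → ∑ (g ∘ part) ≡ a * ∑ (g ∘ heavy) + b * ∑ g
    blocks-part g = trans (blocks (g ∘ part)) (cong₂ _+_
      (trans (sum-cong-≗ {a} (λ i → sum-cong-≗ {5} (λ j → cong g (part-left i j)))) (∑-const a _))
      (trans (sum-cong-≗ {b} (λ i → sum-cong-≗ {8} (λ j → cong g (part-right i j)))) (∑-const b _)))

  blowup : SimpleGraph n
  blowup = induced wagner part

  blowup-admissible : Admissible blowup (2 * a + 3 * b)
  blowup-admissible = record
    { triangleFree = λ i j k → wagner-triangleFree (part i) (part j) (part k)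
    ; indep≤ = λ S ind → ≤-trans (≤-reflexive (blocks (bit ∘ S)))
        (≤-trans (+-mono-≤
            (≤-trans (∑-mono {a} (λ i → heavy-indep (λ j → S (left i j)) (λ j k Sj Sk jk →
              ind _ _ Sj Sk (subst₂ (Adj wagner) (sym (part-left i j)) (sym (part-left i k)) jk)))) (≤-reflexive (∑-const a 2)))
            (≤-trans (∑-mono {b} (λ i → wagner-indep (λ j → S (right i j)) (λ j k Sj Sk jk →
              ind _ _ Sj Sk (subst₂ (Adj wagner) (sym (part-right i j)) (sym (part-right i k)) jk)))) (≤-reflexive (∑-const b 3))))
          (≤-reflexive (cong₂ _+_ (*-comm a 2) (*-comm b 3))))
    }

  -- Every vertex has degree `2 * a + 3 * b`, except in part 2: its neighbours are the parts 5, 6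
  -- and 7, of which only 6 is heavy, so its `b` vertices have degree `a + 3 * b`. They account for
  -- the whole loss `a * b` against `n * s`.
  blowup-degsum : degsum blowup ≡ 10 * (a * a) + 30 * (a * b) + 24 * (b * b)
  blowup-degsum = trans (sum-cong-≗ {n} (λ v → blocks-part (λ j → bit (adj wagner (part v) j))))
    (trans (blocks-part (λ i → a * ∑ (λ j → bit (adj wagner i (heavy j))) + b * ∑ (λ j → bit (adj wagner i j)))) (count a b))
    where
    count : ∀ a b → a * ∑ (λ i → a * ∑ (λ j → bit (adj wagner (heavy i) (heavy j))) + b * ∑ (λ j → bit (adj wagner (heavy i) j))) +
      b * ∑ (λ i → a * ∑ (λ j → bit (adj wagner i (heavy j))) + b * ∑ (λ j → bit (adj wagner i j))) ≡
      10 * (a * a) + 30 * (a * b) + 24 * (b * b)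
    count a b = eq a b
      where
      eq : ∀ a b → a * (a * 2 + b * 3 + (a * 2 + b * 3 + (a * 2 + b * 3 + (a * 2 + b * 3 + (a * 2 + b * 3 + 0))))) +
        b * (a * 2 + b * 3 + (a * 2 + b * 3 + (a * 1 + b * 3 + (a * 2 + b * 3 + (a * 2 + b * 3 + (a * 2 + b * 3 + (a * 2 + b * 3 + (a * 2 + b * 3 + 0)))))))) ≡
        10 * (a * a) + 30 * (a * b) + 24 * (b * b)
      eq = solve-∀

edges-arith : ∀ a b {n s e} → n ≡ a * 5 + b * 8 → s ≡ 2 * a + 3 * b →
  e + e ≡ 10 * (a * a) + 30 * (a * b) + 24 * (b * b) → e + 15 * n * s ≡ 3 * n * n + 20 * s * s
edges-arith a b {n} {s} {e} n≡ s≡ h = *-cancelˡ-≡ (e + 15 * n * s) (3 * n * n + 20 * s * s) 2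
  (trans (expand n s e) (trans (cong (_+ 30 * (n * s)) h) (collect n≡ s≡)))
  where
  expand : ∀ n s e → 2 * (e + 15 * n * s) ≡ e + e + 30 * (n * s)
  expand = solve-∀
  collect : ∀ {n s} → n ≡ a * 5 + b * 8 → s ≡ 2 * a + 3 * b →
    10 * (a * a) + 30 * (a * b) + 24 * (b * b) + 30 * (n * s) ≡ 2 * (3 * n * n + 20 * s * s)
  collect refl refl = eq a b
    where
    eq : ∀ a b → let n = a * 5 + b * 8; s = 2 * a + 3 * b in
      10 * (a * a) + 30 * (a * b) + 24 * (b * b) + 30 * (n * s) ≡ 2 * (3 * n * n + 20 * s * s)
    eq = solve-∀

extremal-graph : ∀ {n s} → 3 * n ≤ 8 * s → 5 * s ≤ 2 * n →
  Σ[ G ∈ SimpleGraph n ] (TriangleFree G × IndepNumberAtMost G s × edgeCount G + 15 * n * s ≡ 3 * n * n + 20 * s * s)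
extremal-graph {n} {s} 3n≤8s 5s≤2n = go a b (trans (proj₁ ns) (cong₂ _+_ (*-comm 5 a) (*-comm 8 b))) (proj₂ ns)
  where
  a = 8 * s ∸ 3 * n
  b = 2 * n ∸ 5 * s
  ns = parameters {n} {s} {a} {b} (sym (m+[n∸m]≡n 3n≤8s)) (sym (m+[n∸m]≡n 5s≤2n))
  go : ∀ {n s} a b → n ≡ a * 5 + b * 8 → s ≡ 2 * a + 3 * b →
    Σ[ G ∈ SimpleGraph n ] (TriangleFree G × IndepNumberAtMost G s × edgeCount G + 15 * n * s ≡ 3 * n * n + 20 * s * s)
  go a b refl refl = blowup a b , triangleFree (blowup-admissible a b) , admissible⁻¹ (blowup-admissible a b) ,
    edges-arith a b refl refl (trans (sym (degsum≡2edgeCount (blowup a b))) (blowup-degsum a b))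

≤-pos : ∀ n s e → e + 15 * n * s ≤ 3 * n * n + 20 * s * s →
  pos e ≤ℤ (pos 3 *ℤ pos n *ℤ pos n) -ℤ (pos 15 *ℤ pos n *ℤ pos s) +ℤ (pos 20 *ℤ pos s *ℤ pos s)
≤-pos n s e h = begin
  pos e ≡⟨ pos≡⊖ e (15 * n * s) ⟩
  (e + 15 * n * s) ⊖ (15 * n * s) ≤⟨ ℤ.⊖-monoˡ-≤ (15 * n * s) h ⟩
  (3 * n * n + 20 * s * s) ⊖ (15 * n * s) ≡⟨ edge-bound-ℤ n s ⟨
  (pos 3 *ℤ pos n *ℤ pos n) -ℤ (pos 15 *ℤ pos n *ℤ pos s) +ℤ (pos 20 *ℤ pos s *ℤ pos s) ∎
  where open ℤ.≤-Reasoning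

≡-pos : ∀ n s e → e + 15 * n * s ≡ 3 * n * n + 20 * s * s →
  pos e ≡ (pos 3 *ℤ pos n *ℤ pos n) -ℤ (pos 15 *ℤ pos n *ℤ pos s) +ℤ (pos 20 *ℤ pos s *ℤ pos s)
≡-pos n s e h = begin
  pos e ≡⟨ pos≡⊖ e (15 * n * s) ⟩
  (e + 15 * n * s) ⊖ (15 * n * s) ≡⟨ cong (_⊖ (15 * n * s)) h ⟩
  (3 * n * n + 20 * s * s) ⊖ (15 * n * s) ≡⟨ edge-bound-ℤ n s ⟨
  (pos 3 *ℤ pos n *ℤ pos n) -ℤ (pos 15 *ℤ pos n *ℤ pos s) +ℤ (pos 20 *ℤ pos s *ℤ pos s) ∎
  where open ≡-Reasoning

theorem3p5 : (n s : ℕ) → s ≤ n →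
    ((G : SimpleGraph n) → TriangleFree G → IndepNumberAtMost G s →
       pos (edgeCount G) ≤ℤ (pos 3 *ℤ pos n *ℤ pos n) -ℤ (pos 15 *ℤ pos n *ℤ pos s) +ℤ (pos 20 *ℤ pos s *ℤ pos s))
    × (3 * n ≤ 8 * s → 5 * s ≤ 2 * n →
       Σ[ G ∈ SimpleGraph n ] (TriangleFree G × IndepNumberAtMost G s ×
         (pos (edgeCount G) ≡ (pos 3 *ℤ pos n *ℤ pos n) -ℤ (pos 15 *ℤ pos n *ℤ pos s) +ℤ (pos 20 *ℤ pos s *ℤ pos s))))
theorem3p5 n s _ =
  (λ G tf bounded → ≤-pos n s (edgeCount G) (edge-bound {n} {s} {G} tf bounded)) ,
  λ 3n≤8s 5s≤2n → let (G , tf , bounded , e) = extremal-graph 3n≤8s 5s≤2n in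
    G , tf , bounded , ≡-pos n s (edgeCount G) e
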